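{- An epr-sequence starting with $\mathtt{S}$ is attainable by a symmetric matrix over $\mathbb{Z}_2$ if and only if it has one of the following forms: 1. $\mathtt{S}\overline{\mathtt{S}}\mathtt{N}\overline{\mathtt{N}}$; 2. $\mathtt{S}\overline{\mathtt{S}}\mathtt{A}$; 3. $\mathtt{S}\overline{\mathtt{S}}\mathtt{AA}$; 4. $\mathtt{SS}\overline{\mathtt{S}}\mathtt{AN}$; 5. $\mathtt{SASA}\overline{\mathtt{SA}}$; 6. $\mathtt{SASA}\overline{\mathtt{SA}}\mathtt{A}$; 7. $\mathtt{SA}\overline{\mathtt{SA}}\mathtt{N}$.
   Context: $\mathbb{Z}_2$ is the field of integers modulo $2$. For an $n\times n$ symmetric matrix $B$ over a field $\mathbb{F}$, the enhanced principal rank characteristic sequence (epr-sequence) is $\operatorname{epr}(B)=\ell_1\ell_2\cdots\ell_n$, where $\ell_k=\mathtt{A}$ if all principal minors of $B$ of order $k$ are nonzero, $\ell_k=\mathtt{S}$ if some but not all principal minors of order $k$ are nonzero, and $\ell_k=\mathtt{N}$ if all principal minors of order $k$ are zero. A finite nonempty sequence over $\{\mathtt{A},\mathtt{S},\mathtt{N}\}$ is attainable over $\mathbb{F}$ if it equals $\operatorname{epr}(B)$ for some symmetric matrix $B$ over $\mathbb{F}$; its order is its length. In a form, an overlined block $\overline{t_1\cdots t_k}$ stands for the block $t_1\cdots t_k$ repeated any number of times $\geq 0$ (so it may be omitted entirely); a sequence "has a form" if it is obtained by some choice of the repetition numbers, chosen independently for each overlined block. -}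

module Defs where

open import Algebra.Bundles using (CommutativeRing; Semiring)
open import Data.Bool.Base using (true; false)
open import Data.Fin.Base using (Fin; zero; suc; toℕ; punchIn)
open import Data.Fin.Subset using (Subset; ∣_∣)
open import Data.List.Base using (List; length; lookup; concat; replicate)
open import Data.Nat.Base using (ℕ; zero; suc)
import Data.Parity.Properties as Parity
open import Data.Product.Base using (Σ; ∃; _×_)
open import Data.Vec.Base using ([]; _∷_)
open import Level using (0ℓ; _⊔_)
open import Relation.Binary.PropositionalEquality.Core using (_≡_)
open import Relation.Nullary.Negation.Core using (¬_)

data Symbol : Set where
  A S N : Symbol

-- The members of p in increasing order.
members : ∀ {n} (p : Subset n) → Fin ∣ p ∣ → Fin n
members (true  ∷ p) zero    = zero
members (true  ∷ p) (suc i) = suc (members p i)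
members (false ∷ p) i       = suc (members p i)

-- F is meant to be a field, but only its ring structure is used.
module EPR {c ℓ} (F : CommutativeRing c ℓ) where

  open CommutativeRing F hiding (zero)
  open import Algebra.Definitions.RawSemiring (Semiring.rawSemiring semiring)
    using (sum; _^_)

  Matrix : ℕ → Set c
  Matrix n = Fin n → Fin n → Carrier

  Symmetric : ∀ {n} → Matrix n → Set ℓ
  Symmetric B = ∀ i j → B i j ≈ B j i

  -- Laplace expansion along the first row.
  det : ∀ {n} → Matrix n → Carrier
  det {zero}  B = 1#
  det {suc n} B = sum λ j →
    (- 1#) ^ toℕ j * B zero j * det (λ k l → B (suc k) (punchIn j l))

  principalMinor : ∀ {n} → Matrix n → Subset n → Carrier
  principalMinor B p = det (λ i j → B (members p i) (members p j))

  AllNonzero SomeNonzero AllZero : ∀ {n} → Matrix n → ℕ → Set ℓ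
  AllNonzero  B k = ∀ p → ∣ p ∣ ≡ k → ¬ (principalMinor B p ≈ 0#)
  SomeNonzero B k = ∃ λ p → ∣ p ∣ ≡ k × ¬ (principalMinor B p ≈ 0#)
  AllZero     B k = ∀ p → ∣ p ∣ ≡ k → principalMinor B p ≈ 0#

  HasSymbol : ∀ {n} → Matrix n → ℕ → Symbol → Set ℓ
  HasSymbol B k A = AllNonzero B k
  HasSymbol B k S = SomeNonzero B k × ¬ AllNonzero B k
  HasSymbol B k N = AllZero B k

  -- epr(B) = s.  Position i of the list, counted from 0, holds the symbol
  -- for order i + 1.
  IsEpr : (s : List Symbol) → Matrix (length s) → Set ℓ
  IsEpr s B = ∀ (i : Fin (length s)) → HasSymbol B (suc (toℕ i)) (lookup s i)

  -- Meaningful for nonempty s: the empty list is vacuously attainable.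
  Attainable : List Symbol → Set (c ⊔ ℓ)
  Attainable s = Σ (Matrix (length s)) λ B → Symmetric B × IsEpr s B

-- The integers modulo 2, represented by parities.
ℤ₂ : CommutativeRing 0ℓ 0ℓ
ℤ₂ = Parity.+-*-commutativeRing

infix 8 _×[_]

-- k ×[ t ] is the block t repeated k times: one choice for an overlined t.
_×[_] : ℕ → List Symbol → List Symbol
k ×[ t ] = concat (replicate k t)

{-# OPTIONS --safe #-}
module Submission where

-- A set X of indices is called feasible when the principal minor B[X] is nonzero, that is, when no v ≠ 0
-- vanishes off X with B v vanishing on X. If P is feasible, exchanging the coordinates in P of v and B v
-- gives a symmetric matrix D, the principal pivot transform, whose feasible sets are those of B shifted by
-- Δ P.
--
-- Necessity. Let B have a nonzero and a zero diagonal entry. If all minors of order k ≥ 1 vanish and P is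
-- feasible of order k + 1, then D has zero diagonal on P and B, D have the same diagonal. An index u with
-- b_uu = 1 is thus outside P, and {x, y, u} Δ P having order k forces D[P] = 0, which is absurd: so N is
-- followed by N only. If all minors of order k ≥ 2 are nonzero and k + 2 ≤ n, pivoting at P of order k
-- makes the minors of order 2 across P, and of order 4 halved by P, nonzero. This forces d_xy = 1 + d_xx
-- d_yy for all x ≠ y, by evaluating 2 × 2 and 4 × 4 determinants. A set is then infeasible for D iff it
-- has odd order and an even number of indices x with d_xx = 1. Hence every set of the parity of P is
-- feasible for B; since B has a zero on the diagonal, k is even and B has the same shape as D, whose
-- sequence alternates between S and A up to the last symbol.
--
-- Sufficiency. Matrices J + d dᵀ + I give the alternating forms, a tree Laplacian gives SS…SAN, and small
-- blocks padded by an identity or by zeros give the rest.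

open import Defs
open import Data.List.Base using (List; []; _∷_; _++_; [_])
open import Data.Product.Base using (∃-syntax)
open import Data.Sum.Base using (_⊎_)
open import Function.Bundles using (_⇔_)
open import Relation.Binary.PropositionalEquality.Core using (_≡_)

open import Data.Bool.Base using (true; false; not; if_then_else_)
open import Data.Fin.Base using (Fin; zero; suc; toℕ; punchIn; punchOut)
open import Data.Fin.Permutation using (Permutation′; _⟨$⟩ʳ_; remove; punchIn-permute; transpose)
open import Data.Fin.Properties using (_≟_; any?; suc-injective; punchInᵢ≢i; punchIn-injective; punchIn-punchOut; punchOut-injective)
open import Data.Fin.Subset using (Subset; ∣_∣; ⊤)
open import Data.Fin.Subset.Properties using (∣p∣≤n; ∣⊤∣≡n; ∣p∣≡n⇒p≡⊤)
open import Data.List.Base using (length; lookup)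
open import Data.List.Properties using (++-identityʳ)
open import Data.Nat.Base as ℕ using (ℕ; zero; suc; _≤_; _<_; z≤n; s≤s; parity)
import Data.Nat.Properties as ℕ
-- In Data.Parity.Base, _+_ and _*_ have the same precedence.
open import Data.Parity.Base using (Parity; 0ℙ; 1ℙ; _⁻¹; _*_) renaming (_+_ to infixl 6 _+_)
import Data.Parity.Properties as Parity
open import Data.Product.Base using (∃; _×_; _,_; proj₁; proj₂)
open import Data.Sum.Base using (inj₁; inj₂)
open import Data.Unit.Base using (tt) renaming (⊤ to Unit)
open import Data.Vec.Base using ([]; _∷_)
open import Data.Vec.Functional using (insertAt; updateAt) renaming (_∷_ to _◂_)
open import Data.Vec.Functional.Properties using (insertAt-lookup; insertAt-punchIn; updateAt-updates; updateAt-minimal)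
open import Function.Base using (_∘_; const; flip)
open import Function.Bundles using (mk⇔)
open import Relation.Binary.PropositionalEquality.Core using (_≢_; _≗_; refl; sym; trans; cong; cong₂; subst; subst₂)
open import Relation.Binary.PropositionalEquality.Properties using (module ≡-Reasoning)
open import Relation.Nullary.Decidable using (Dec; yes; no; map′; from-yes; _→-dec_; _×-dec_)
open import Relation.Nullary.Negation using (¬_; contradiction)
open import Algebra.Properties.Semiring.Sum Parity.+-*-semiring
  using (sum; sum-cong-≗; sum-remove; sum-permute; sum-replicate-zero; ∑-distrib-+; ∑-comm; *-distribʳ-sum)

open EPR ℤ₂

-- Vectors and matrices over ℤ₂.

infixl 8 _·_ _⊙_

Mat : ℕ → ℕ → Set
Mat m n = Fin m → Fin n → Parity

_⊙_ : ∀ {n} → (Fin n → Parity) → (Fin n → Parity) → Parity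
u ⊙ v = sum λ j → u j * v j

_·_ : ∀ {m n} → Mat m n → (Fin n → Parity) → Fin m → Parity
(M · v) i = M i ⊙ v

-- A statement about finitely many parities is decided by trying all values; polynomial identities
-- and small determinants are settled this way, by evaluation through `from-yes`.
∀ℙ? : ∀ {ℓ} {P : Parity → Set ℓ} → (∀ x → Dec (P x)) → Dec (∀ x → P x)
∀ℙ? P? = map′ (λ { (p , q) 0ℙ → p ; (p , q) 1ℙ → q }) (λ f → f 0ℙ , f 1ℙ)
  (P? 0ℙ ×-dec P? 1ℙ)

≢1⇒≡0 : ∀ {x} → x ≢ 1ℙ → x ≡ 0ℙ
≢1⇒≡0 {0ℙ} _   = refl
≢1⇒≡0 {1ℙ} x≢1 = contradiction refl x≢1

≢0⇒≡1 : ∀ {x} → x ≢ 0ℙ → x ≡ 1ℙ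
≢0⇒≡1 {1ℙ} _   = refl
≢0⇒≡1 {0ℙ} x≢0 = contradiction refl x≢0

0≢1 : ∀ {x} → x ≡ 0ℙ → x ≢ 1ℙ
0≢1 refl ()

x+y≡0⇒x≡y : ∀ x y → x + y ≡ 0ℙ → x ≡ y
x+y≡0⇒x≡y 0ℙ 0ℙ _ = refl
x+y≡0⇒x≡y 1ℙ 1ℙ _ = refl

-- Sums

sum-zero : ∀ {n} {f : Fin n → Parity} → (∀ i → f i ≡ 0ℙ) → sum f ≡ 0ℙ
sum-zero {n} f≡0 = trans (sum-cong-≗ f≡0) (sum-replicate-zero n)

-- `δ x` serves both as the standard basis vector at x and as the indicator of the singleton of x.
δ : ∀ {n} → Fin n → Fin n → Parity
δ zero    zero    = 1ℙ
δ zero    (suc _) = 0ℙ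
δ (suc _) zero    = 0ℙ
δ (suc i) (suc j) = δ i j

δ-refl : ∀ {n} (i : Fin n) → δ i i ≡ 1ℙ
δ-refl zero    = refl
δ-refl (suc i) = δ-refl i

δ-≢ : ∀ {n} {i j : Fin n} → i ≢ j → δ i j ≡ 0ℙ
δ-≢ {i = zero}  {zero}  i≢j = contradiction refl i≢j
δ-≢ {i = zero}  {suc _} _   = refl
δ-≢ {i = suc _} {zero}  _   = refl
δ-≢ {i = suc _} {suc _} i≢j = δ-≢ (i≢j ∘ cong suc)

δ-sym : ∀ {n} (i j : Fin n) → δ i j ≡ δ j i
δ-sym zero    zero    = refl
δ-sym zero    (suc _) = refl
δ-sym (suc _) zero    = refl
δ-sym (suc i) (suc j) = δ-sym i j

sum-δ : ∀ {n} (i : Fin n) (f : Fin n → Parity) → sum (λ j → δ i j * f j) ≡ f i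
sum-δ zero    f = trans (cong (f zero +_) (sum-zero {f = λ j → 0ℙ * f (suc j)} λ _ → refl))
    (Parity.+-identityʳ (f zero))
sum-δ (suc i) f = sum-δ i (f ∘ suc)

-- In characteristic 2 two equal terms cancel; f is the sum of its restrictions to c and to d.
sum-cancel : ∀ {n} {c d : Fin n} {f : Fin n → Parity} → c ≢ d → f c ≡ f d →
  (∀ j → j ≢ c → j ≢ d → f j ≡ 0ℙ) → sum f ≡ 0ℙ
sum-cancel {c = c} {d} {f} c≢d fc≡fd f≡0 = begin
  sum f                                                    ≡⟨ sum-cong-≗ split ⟩
  sum (λ j → δ c j * f j + δ d j * f j)                    ≡⟨ ∑-distrib-+ (λ j → δ c j * f j) (λ j → δ d j * f j) ⟩
  sum (λ j → δ c j * f j) + sum (λ j → δ d j * f j)        ≡⟨ cong₂ _+_ (sum-δ c f) (sum-δ d f) ⟩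
  f c + f d                                                ≡⟨ cong (_+ f d) fc≡fd ⟩
  f d + f d                                                ≡⟨ Parity.p+p≡0ℙ (f d) ⟩
  0ℙ                                                       ∎
  where
  open ≡-Reasoning
  split : ∀ j → f j ≡ δ c j * f j + δ d j * f j
  split j with c ≟ j | d ≟ j
  ... | yes refl | _ rewrite δ-refl c | δ-≢ (c≢d ∘ sym) = sym (Parity.+-identityʳ _)
  ... | no c≢j | yes refl rewrite δ-refl d | δ-≢ c≢d = refl
  ... | no c≢j | no d≢j rewrite δ-≢ c≢j | δ-≢ d≢j = f≡0 j (c≢j ∘ sym) (d≢j ∘ sym)

⊙-congˡ : ∀ {n} (w : Fin n → Parity) {u v} → u ≗ v → w ⊙ u ≡ w ⊙ v
⊙-congˡ w u≗v = sum-cong-≗ λ j → cong (w j *_) (u≗v j)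

⊙-congʳ : ∀ {n} (w : Fin n → Parity) {u v} → u ≗ v → u ⊙ w ≡ v ⊙ w
⊙-congʳ w u≗v = sum-cong-≗ λ j → cong (_* w j) (u≗v j)

⊙-comm : ∀ {n} (u v : Fin n → Parity) → u ⊙ v ≡ v ⊙ u
⊙-comm u v = sum-cong-≗ λ j → Parity.*-comm (u j) (v j)

⊙-+ : ∀ {n} (w u v : Fin n → Parity) → w ⊙ (λ j → u j + v j) ≡ w ⊙ u + w ⊙ v
⊙-+ w u v = trans (sum-cong-≗ λ j → Parity.*-distribˡ-+ (w j) (u j) (v j))
  (∑-distrib-+ (λ j → w j * u j) (λ j → w j * v j))

+-⊙ : ∀ {n} (u v w : Fin n → Parity) → (λ j → u j + v j) ⊙ w ≡ u ⊙ w + v ⊙ w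
+-⊙ u v w = trans (⊙-comm (λ j → u j + v j) w)
  (trans (⊙-+ w u v) (cong₂ _+_ (⊙-comm w u) (⊙-comm w v)))

*-⊙ : ∀ {n} c (u v : Fin n → Parity) → (λ j → c * u j) ⊙ v ≡ c * (u ⊙ v)
*-⊙ 0ℙ u v = sum-zero {f = λ j → 0ℙ * v j} λ _ → refl
*-⊙ 1ℙ u v = refl

⊙-* : ∀ {n} c (u v : Fin n → Parity) → u ⊙ (λ j → c * v j) ≡ c * (u ⊙ v)
⊙-* c u v = trans (⊙-comm u (λ j → c * v j)) (trans (*-⊙ c v u) (cong (c *_) (⊙-comm v u)))

⊙-zeroʳ : ∀ {n} (u : Fin n → Parity) {v} → (∀ j → v j ≡ 0ℙ) → u ⊙ v ≡ 0ℙ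
⊙-zeroʳ u v≡0 = sum-zero λ j → trans (cong (u j *_) (v≡0 j)) (Parity.*-zeroʳ (u j))

⊙-δ : ∀ {n} (u : Fin n → Parity) x → u ⊙ δ x ≡ u x
⊙-δ u x = trans (⊙-comm u (δ x)) (sum-δ x u)

-- Linear systems over ℤ₂

Nonzero : ∀ {n} → (Fin n → Parity) → Set
Nonzero v = ∃ λ i → v i ≡ 1ℙ

Injective : ∀ {m n} → Mat m n → Set
Injective M = ∀ v → (∀ i → (M · v) i ≡ 0ℙ) → ∀ j → v j ≡ 0ℙ

-- Gaussian elimination, one row at a time. A zero row is dropped together with the first column,
-- whose unknown is set to 0. A row with a 1 in column j clears that column from the rows below it.
underdetermined : ∀ {m} (M : Mat m (suc m)) →
  ∃ λ v → Nonzero v × (∀ i → (M · v) i ≡ 0ℙ)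
underdetermined {zero}  M = const 1ℙ , (zero , refl) , λ ()
underdetermined {suc m} M with any? (λ j → M zero j Parity.≟ 1ℙ)
... | no ∄1 with underdetermined (λ i j → M (suc i) (suc j))
...   | u , (k , uk≡1) , Mu≡0 = 0ℙ ◂ u , (suc k , uk≡1) , Mv≡0
  where
  Mv≡0 : ∀ i → (M · (0ℙ ◂ u)) i ≡ 0ℙ
  Mv≡0 zero    = sum-zero {f = λ j → M zero j * (0ℙ ◂ u) j}
    λ j → cong (_* (0ℙ ◂ u) j) (≢1⇒≡0 λ eq → ∄1 (j , eq))
  Mv≡0 (suc i) = trans (cong (_+ ((λ j → M (suc i) (suc j)) ⊙ u)) (Parity.*-zeroʳ (M (suc i) zero))) (Mu≡0 i)
underdetermined {suc m} M | yes (j , Mj≡1)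
  with underdetermined (λ i k → M (suc i) (punchIn j k) + M (suc i) j * M zero (punchIn j k))
... | u , (k , uk≡1) , M′u≡0 = v , (punchIn j k , trans (insertAt-punchIn u j t k) uk≡1) , Mv≡0
  where
  -- The first row has coefficient 1 at j, so this value of the unknown at j makes the first
  -- equation hold.
  t = sum λ k → M zero (punchIn j k) * u k
  v = insertAt u j t
  Mv : ∀ i → (M · v) i ≡ M i j * t + (M i ∘ punchIn j) ⊙ u
  Mv i = trans (sum-remove {i = j} λ l → M i l * v l)
    (cong₂ (λ a b → M i j * a + b) (insertAt-lookup u j t)
      (sum-cong-≗ λ k → cong (M i (punchIn j k) *_) (insertAt-punchIn u j t k)))
  open ≡-Reasoning
  Mv≡0 : ∀ i → (M · v) i ≡ 0ℙ
  Mv≡0 zero    = trans (Mv zero) (trans (cong (λ a → a * t + t) Mj≡1) (Parity.p+p≡0ℙ t))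
  Mv≡0 (suc i) = begin
    (M · v) (suc i)            ≡⟨ Mv (suc i) ⟩
    a * t + b ⊙ u              ≡⟨ Parity.+-comm (a * t) (b ⊙ u) ⟩
    b ⊙ u + a * t              ≡⟨ cong (b ⊙ u +_) (*-⊙ a c u) ⟨
    b ⊙ u + (λ k → a * c k) ⊙ u ≡⟨ +-⊙ b (λ k → a * c k) u ⟨
    (λ k → b k + a * c k) ⊙ u  ≡⟨ M′u≡0 i ⟩
    0ℙ                         ∎
    where
    a = M (suc i) j
    b = M (suc i) ∘ punchIn j
    c = M zero ∘ punchIn j

-- With b put in front of M as an extra column, there is a nonzero solution. If its leading
-- coordinate is 1, the remaining ones solve M v = b; if it is 0, they contradict injectivity.
injective⇒surjective : ∀ {n} (M : Mat n n) → Injective M → (b : Fin n → Parity) → ∃ λ v → ∀ i → (M · v) i ≡ b i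
injective⇒surjective M inj b with underdetermined (λ i → b i ◂ M i)
... | v , (k , vk≡1) , eq = solve (v zero) refl
  where
  Mv : ∀ c → v zero ≡ c → ∀ i → b i * c + (M · (v ∘ suc)) i ≡ 0ℙ
  Mv _ refl = eq
  solve : ∀ c → v zero ≡ c → ∃ λ v → ∀ i → (M · v) i ≡ b i
  solve 1ℙ v₀ = v ∘ suc , λ i → trans (sym (x+y≡0⇒x≡y (b i * 1ℙ) _ (Mv 1ℙ v₀ i))) (Parity.*-identityʳ (b i))
  solve 0ℙ v₀ = contradiction vk≡1 (0≢1 (v≡0 k))
    where
    v≡0 : ∀ j → v j ≡ 0ℙ
    v≡0 zero    = v₀
    v≡0 (suc j) = inj (v ∘ suc)
      (λ i → trans (cong (_+ (M · (v ∘ suc)) i) (sym (Parity.*-zeroʳ (b i)))) (Mv 0ℙ v₀ i)) j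

-- Determinants over ℤ₂

minor : ∀ {n} → Mat (suc n) (suc n) → Fin (suc n) → Mat n n
minor M j k l = M (suc k) (punchIn j l)

-- In ℤ₂ the signs are powers of -1 = 1.
det-laplace : ∀ {n} (M : Mat (suc n) (suc n)) → det M ≡ M zero ⊙ (λ j → det (minor M j))
det-laplace M = sum-cong-≗ λ j → cong (λ s → s * M zero j * det (minor M j)) (1^k≡1 (toℕ j))
  where
  open import Algebra.Definitions.RawSemiring Data.Parity.Base.+-*-rawSemiring using (_^_)
  1^k≡1 : ∀ k → 1ℙ ^ k ≡ 1ℙ
  1^k≡1 zero    = refl
  1^k≡1 (suc k) = 1^k≡1 k

det-cong : ∀ {n} {M M′ : Mat n n} → (∀ i j → M i j ≡ M′ i j) → det M ≡ det M′
det-cong {zero}  eq = refl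
det-cong {suc n} {M} {M′} eq = begin
  det M                                ≡⟨ det-laplace M ⟩
  M zero ⊙ (λ j → det (minor M j))     ≡⟨ sum-cong-≗
      (λ j → cong₂ _*_ (eq zero j) (det-cong λ k l → eq (suc k) (punchIn j l))) ⟩
  M′ zero ⊙ (λ j → det (minor M′ j))   ≡⟨ det-laplace M′ ⟨
  det M′                               ∎
  where open ≡-Reasoning

-- Over ℤ₂ the determinant is a permanent.
det-permute : ∀ {n} (M : Mat n n) (π : Permutation′ n) → det (λ i j → M i (π ⟨$⟩ʳ j)) ≡ det M
det-permute {zero}  M π = refl
det-permute {suc n} M π = begin
  det Mπ                                                        ≡⟨ det-laplace Mπ ⟩
  Mπ zero ⊙ (λ j → det (minor Mπ j))                            ≡⟨ ⊙-congˡ (Mπ zero) (λ j → trans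
    (det-cong λ k l → cong (M (suc k)) (punchIn-permute π j l)) (det-permute (minor M (π ⟨$⟩ʳ j)) (remove j π))) ⟩
  Mπ zero ⊙ (λ j → det (minor M (π ⟨$⟩ʳ j)))                    ≡⟨ sum-permute (λ j → M zero j * det (minor M j)) π ⟨
  M zero ⊙ (λ j → det (minor M j))                              ≡⟨ det-laplace M ⟨
  det M                                                         ∎
  where
  open ≡-Reasoning
  Mπ : Mat (suc n) (suc n)
  Mπ i j = M i (π ⟨$⟩ʳ j)

-- In the expansion along the first row, a minor omitting neither c nor d still has two equal
-- columns. The minors omitting c and d have the same columns up to order, so these two terms are
-- equal and cancel.
det-alternating : ∀ {n} (M : Mat n n) {c d} → c ≢ d → (∀ i → M i c ≡ M i d) → det M ≡ 0ℙ
det-alternating {suc n} M {c} {d} c≢d eq = trans (det-laplace M)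
  (sum-cancel {f = λ j → M zero j * det (minor M j)} c≢d
    (cong₂ _*_ (eq zero) minors) λ j j≢c j≢d → trans (cong (M zero j *_)
      (det-alternating (minor M j) (c≢d ∘ punchOut-injective j≢c j≢d) λ k →
          trans (cong (M (suc k)) (punchIn-punchOut j≢c)) (trans (eq (suc k))
        (sym (cong (M (suc k)) (punchIn-punchOut j≢d)))))) (Parity.*-zeroʳ (M zero j)))
  where
  open ≡-Reasoning
  π = transpose c d
  Mπ : ∀ i j → M i (π ⟨$⟩ʳ j) ≡ M i j
  Mπ i j with j ≟ c
  ... | yes refl = sym (eq i)
  ... | no _ with j ≟ d
  ...   | yes refl = eq i
  ...   | no _     = refl
  πd≡c : π ⟨$⟩ʳ d ≡ c
  πd≡c with d ≟ c
  ... | yes d≡c = d≡c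
  ... | no _ with d ≟ d
  ...   | yes _  = refl
  ...   | no d≢d = contradiction refl d≢d
  minors : det (minor M c) ≡ det (minor M d)
  minors = begin
    det (minor M c)            ≡⟨ cong (det ∘ minor M) πd≡c ⟨
    det (minor M (π ⟨$⟩ʳ d))   ≡⟨ det-permute (minor M (π ⟨$⟩ʳ d)) (remove d π) ⟨
    det (λ k l → minor M (π ⟨$⟩ʳ d) k (remove d π ⟨$⟩ʳ l))
      ≡⟨ det-cong (λ k l → trans (cong (M (suc k)) (sym (punchIn-permute π d l))) (Mπ (suc k) (punchIn d l))) ⟩
    det (minor M d)            ∎

setColumn : ∀ {m n} → Mat m n → Fin n → (Fin m → Parity) → Mat m n
setColumn M c u i = updateAt (M i) c (const (u i))

minor-setColumn : ∀ {n} (M : Mat (suc n) (suc n)) c u k l →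
  minor (setColumn M c u) c k l ≡ minor M c k l
minor-setColumn M c u k l = updateAt-minimal (punchIn c l) c (M (suc k)) (punchInᵢ≢i c l)

minor-setColumn-≢ : ∀ {n} (M : Mat (suc n) (suc n)) {j c} (j≢c : j ≢ c) u k l →
  minor (setColumn M c u) j k l ≡ setColumn (minor M j) (punchOut j≢c) (u ∘ suc) k l
minor-setColumn-≢ M {j} {c} j≢c u k l with l ≟ punchOut j≢c
... | yes refl = trans (cong (setColumn M c u (suc k)) (punchIn-punchOut j≢c))
      (trans (updateAt-updates c (M (suc k))) (sym (updateAt-updates (punchOut j≢c) (minor M j k))))
... | no l≢ = trans (updateAt-minimal (punchIn j l) c (M (suc k))
        λ eq → l≢ (punchIn-injective j l _ (trans eq (sym (punchIn-punchOut j≢c)))))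
      (sym (updateAt-minimal l (punchOut j≢c) (minor M j k) l≢))

-- Linearity in column c. Writing the linear combination as `K · w` lets K be the matrix itself in
-- Cramer's rule.
det-linear : ∀ {m n} (M : Mat n n) c (K : Mat n m) (w : Fin m → Parity) →
  det (setColumn M c (K · w)) ≡ (λ d → det (setColumn M c (λ i → K i d))) ⊙ w
det-linear {n = suc n} M c K w = begin
  det (setColumn M c (K · w))                  ≡⟨ det-laplace (setColumn M c (K · w)) ⟩
  sum (term (K · w))                           ≡⟨ sum-cong-≗ term-linear ⟩
  sum (λ j → (λ d → term (flip K d) j) ⊙ w)    ≡⟨ ∑-comm (λ j d → term (flip K d) j * w d) ⟩
  sum (λ d → sum (λ j → term (flip K d) j * w d))
    ≡⟨ sum-cong-≗ (λ d → trans (cong (_* w d) (det-laplace (setColumn M c (flip K d))))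
        (*-distribʳ-sum (w d) (term (flip K d)))) ⟨
  (λ d → det (setColumn M c (flip K d))) ⊙ w   ∎
  where
  open ≡-Reasoning
  term : (Fin (suc n) → Parity) → Fin (suc n) → Parity
  term u j = setColumn M c u zero j * det (minor (setColumn M c u) j)
  term-linear : ∀ j → term (K · w) j ≡ (λ d → term (flip K d) j) ⊙ w
  term-linear j with j ≟ c
  ... | yes refl = begin
    term (K · w) j               ≡⟨ cong₂ _*_ (updateAt-updates j (M zero)) (det-cong (minor-setColumn M j (K · w))) ⟩
    K zero ⊙ w * det (minor M j) ≡⟨ Parity.*-comm (K zero ⊙ w) _ ⟩
    det (minor M j) * K zero ⊙ w ≡⟨ *-⊙ (det (minor M j)) (K zero) w ⟨
    (λ d → det (minor M j) * K zero d) ⊙ w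
      ≡⟨ ⊙-congʳ w (λ d → trans (cong₂ _*_ (updateAt-updates j (M zero))
          (det-cong (minor-setColumn M j (flip K d)))) (Parity.*-comm (K zero d) _)) ⟨
    (λ d → term (flip K d) j) ⊙ w ∎
  ... | no j≢c = begin
    term (K · w) j               ≡⟨ term≡ (K · w) ⟩
    M zero j * det (setColumn (minor M j) (punchOut j≢c) ((K ∘ suc) · w))
      ≡⟨ cong (M zero j *_) (det-linear (minor M j) (punchOut j≢c) (K ∘ suc) w) ⟩
    M zero j * ((λ d → det (setColumn (minor M j) (punchOut j≢c) (λ i → K (suc i) d))) ⊙ w)
      ≡⟨ *-⊙ (M zero j) (λ d → det (setColumn (minor M j) (punchOut j≢c) (λ i → K (suc i) d))) w ⟨
    (λ d → M zero j * det (setColumn (minor M j) (punchOut j≢c) (λ i → K (suc i) d))) ⊙ w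
      ≡⟨ ⊙-congʳ w (λ d → term≡ (flip K d)) ⟨
    (λ d → term (flip K d) j) ⊙ w ∎
    where
    term≡ : ∀ u → term u j ≡ M zero j * det (setColumn (minor M j) (punchOut j≢c) (u ∘ suc))
    term≡ u = cong₂ _*_ (updateAt-minimal j c (M zero) j≢c) (det-cong (minor-setColumn-≢ M j≢c u))

det-setColumn-cong : ∀ {n} (M : Mat n n) c {u v} → u ≗ v → det (setColumn M c u) ≡ det (setColumn M c v)
det-setColumn-cong M c {u} {v} u≗v = det-cong eq
  where
  eq : ∀ i j → setColumn M c u i j ≡ setColumn M c v i j
  eq i j with j ≟ c
  ... | yes refl = trans (updateAt-updates j (M i)) (trans (u≗v i) (sym (updateAt-updates j (M i))))
  ... | no j≢c   = trans (updateAt-minimal j c (M i) j≢c) (sym (updateAt-minimal j c (M i) j≢c))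

det-setColumn-zero : ∀ {n} (M : Mat n n) c → det (setColumn M c (const 0ℙ)) ≡ 0ℙ
-- The zero column is the empty linear combination.
det-setColumn-zero M c = det-linear {0} M c (λ _ ()) (λ ())

-- Cramer's rule
det-setColumn-· : ∀ {n} (M : Mat n n) c v → det (setColumn M c (M · v)) ≡ v c * det M
det-setColumn-· M c v = begin
  det (setColumn M c (M · v))                       ≡⟨ det-linear M c M v ⟩
  (λ d → det (setColumn M c (flip M d))) ⊙ v        ≡⟨ ⊙-congʳ v column ⟩
  (λ d → det M * δ c d) ⊙ v                         ≡⟨ *-⊙ (det M) (δ c) v ⟩
  det M * (δ c ⊙ v)                                 ≡⟨ cong (det M *_) (sum-δ c v) ⟩
  det M * v c                                       ≡⟨ Parity.*-comm (det M) (v c) ⟩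
  v c * det M                                       ∎
  where
  open ≡-Reasoning
  same : ∀ i j → setColumn M c (flip M c) i j ≡ M i j
  same i j with j ≟ c
  ... | yes refl = updateAt-updates j (M i)
  ... | no j≢c   = updateAt-minimal j c (M i) j≢c
  column : ∀ d → det (setColumn M c (flip M d)) ≡ det M * δ c d
  column d with d ≟ c
  ... | yes refl = trans (det-cong same) (trans (sym (Parity.*-identityʳ (det M))) (cong (det M *_) (sym (δ-refl d))))
  ... | no d≢c   = trans (det-alternating (setColumn M c (flip M d)) (d≢c ∘ sym)
        (λ i → trans (updateAt-updates c (M i)) (sym (updateAt-minimal d c (M i) d≢c))))
        (sym (trans (cong (det M *_) (δ-≢ (d≢c ∘ sym))) (Parity.*-zeroʳ (det M))))

-- Cramer's rule with right-hand side 0 expresses each coordinate as a determinant with a zero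
-- column.
det≡1⇒injective : ∀ {n} (M : Mat n n) → det M ≡ 1ℙ → Injective M
det≡1⇒injective M det≡1 v Mv≡0 c = begin
  v c                          ≡⟨ Parity.*-identityʳ (v c) ⟨
  v c * 1ℙ                     ≡⟨ cong (v c *_) det≡1 ⟨
  v c * det M                  ≡⟨ det-setColumn-· M c v ⟨
  det (setColumn M c (M · v))  ≡⟨ det-setColumn-cong M c Mv≡0 ⟩
  det (setColumn M c (const 0ℙ)) ≡⟨ det-setColumn-zero M c ⟩
  0ℙ                           ∎
  where open ≡-Reasoning

-- In the expansion along the first row, every minor that keeps column c has a zero column there.
det-setColumn-δ₀ : ∀ {n} (M : Mat (suc n) (suc n)) c → det (setColumn M c (δ zero)) ≡ det (minor M c)
det-setColumn-δ₀ M c = begin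
  det M′                                ≡⟨ det-laplace M′ ⟩
  M′ zero ⊙ (λ j → det (minor M′ j))    ≡⟨ sum-cong-≗ term ⟩
  δ c ⊙ (λ j → det (minor M j))         ≡⟨ sum-δ c (λ j → det (minor M j)) ⟩
  det (minor M c)                       ∎
  where
  open ≡-Reasoning
  M′ = setColumn M c (δ zero)
  term : ∀ j → M′ zero j * det (minor M′ j) ≡ δ c j * det (minor M j)
  term j with j ≟ c
  ... | yes refl = cong₂ _*_ (trans (updateAt-updates j (M zero)) (sym (δ-refl j)))
        (det-cong (minor-setColumn M j (δ zero)))
  ... | no j≢c   = trans (cong (M′ zero j *_) (trans (det-cong (minor-setColumn-≢ M j≢c (δ zero)))
          (det-setColumn-zero (minor M j) (punchOut j≢c))))
        (trans (Parity.*-zeroʳ (M′ zero j)) (sym (cong (_* det (minor M j)) (δ-≢ (j≢c ∘ sym)))))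

-- Some v with v c = 1 is annihilated by all rows but the first, so M v is the first basis vector.
-- Cramer's rule at c reduces the determinant to the minor without row 0 and column c, which is
-- injective in turn.
injective⇒det≡1 : ∀ {n} (M : Mat n n) → Injective M → det M ≡ 1ℙ
injective⇒det≡1 {zero}  M inj = refl
injective⇒det≡1 {suc n} M inj with underdetermined (M ∘ suc)
... | v , (c , vc≡1) , Mv≡0 = begin
  det M                        ≡⟨ cong (_* det M) vc≡1 ⟨
  v c * det M                  ≡⟨ det-setColumn-· M c v ⟨
  det (setColumn M c (M · v))  ≡⟨ det-setColumn-cong M c Mv≡δ₀ ⟩
  det (setColumn M c (δ zero)) ≡⟨ det-setColumn-δ₀ M c ⟩
  det (minor M c)              ≡⟨ injective⇒det≡1 (minor M c) minor-injective ⟩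
  1ℙ                           ∎
  where
  open ≡-Reasoning
  nonzero : (M · v) zero ≢ 0ℙ
  nonzero eq = 0≢1 (inj v (λ { zero → eq ; (suc i) → Mv≡0 i }) c) vc≡1
  Mv≡δ₀ : ∀ i → (M · v) i ≡ δ zero i
  Mv≡δ₀ zero    = ≢0⇒≡1 nonzero
  Mv≡δ₀ (suc i) = Mv≡0 i
  minor-injective : Injective (minor M c)
  minor-injective u mu≡0 j = trans (sym (insertAt-punchIn u c 0ℙ j)) (case ((M · u′) zero) refl)
    where
    u′ = insertAt u c 0ℙ
    Mu′ : ∀ i → (M · u′) (suc i) ≡ 0ℙ
    Mu′ i = trans (sum-remove {i = c} (λ l → M (suc i) l * u′ l))
      (cong₂ _+_ (trans (cong (M (suc i) c *_) (insertAt-lookup u c 0ℙ)) (Parity.*-zeroʳ (M (suc i) c)))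
        (trans (sum-cong-≗ λ k → cong (M (suc i) (punchIn c k) *_) (insertAt-punchIn u c 0ℙ k)) (mu≡0 i)))
    case : ∀ b → (M · u′) zero ≡ b → u′ (punchIn c j) ≡ 0ℙ
    case 0ℙ eq = inj u′ (λ { zero → eq ; (suc i) → Mu′ i }) (punchIn c j)
    -- Otherwise u′ + v lies in the kernel, although its coordinate at c is 0 + 1.
    case 1ℙ eq = contradiction
      (cong₂ _+_ (insertAt-lookup u c 0ℙ) vc≡1)
      (0≢1 (inj (λ l → u′ l + v l) (λ i → trans (⊙-+ (M i) u′ v)
          (trans (cong₂ _+_ (M·u′ i) (Mv≡δ₀ i)) (Parity.p+p≡0ℙ (δ zero i)))) c))
      where
      M·u′ : ∀ i → (M · u′) i ≡ δ zero i
      M·u′ zero    = eq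
      M·u′ (suc i) = Mu′ i

-- Principal minors as systems of equations

χ : ∀ {n} → Subset n → Fin n → Parity
χ (b ∷ p) zero    = if b then 1ℙ else 0ℙ
χ (b ∷ p) (suc i) = χ p i

χ∘members : ∀ {n} (p : Subset n) i → χ p (members p i) ≡ 1ℙ
χ∘members (true  ∷ p) zero    = refl
χ∘members (true  ∷ p) (suc i) = χ∘members p i
χ∘members (false ∷ p) i       = χ∘members p i

-- Covers both `members p`, which gives the principal minors, and `lookup xs` for an explicit list
-- of indices, which gives small determinants with entries in a chosen order.
record Enumeration {k n} (z : Fin k → Fin n) (X : Fin n → Parity) : Set where
  field
    injective : ∀ i j → z i ≡ z j → i ≡ j
    sound     : ∀ i → X (z i) ≡ 1ℙ
    complete  : ∀ r → X r ≡ 1ℙ → ∃ λ i → z i ≡ r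

χ-enumeration : ∀ {n} (p : Subset n) → Enumeration (members p) (χ p)
χ-enumeration p = record { injective = injective p ; sound = χ∘members p ; complete = complete p }
  where
  injective : ∀ {n} (p : Subset n) i j → members p i ≡ members p j → i ≡ j
  injective (true  ∷ p) zero    zero    _  = refl
  injective (true  ∷ p) (suc i) (suc j) eq = cong suc (injective p i j (suc-injective eq))
  injective (false ∷ p) i       j       eq = injective p i j (suc-injective eq)
  complete : ∀ {n} (p : Subset n) r → χ p r ≡ 1ℙ → ∃ λ i → members p i ≡ r
  complete (true  ∷ p) zero    _ = zero , refl
  complete (true  ∷ p) (suc r) eq with complete p r eq
  ... | i , refl = suc i , refl
  complete (false ∷ p) (suc r) eq with complete p r eq
  ... | i , refl = i , refl

mix : Parity → Parity → Parity → Parity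
mix 0ℙ a b = a
mix 1ℙ a b = b

-- pivoted and copivoted exchange the coordinates in X of v and B v, so that Feasible B X is nonsingularity of B[X].
pivoted copivoted : ∀ {n} → Matrix n → (Fin n → Parity) → (Fin n → Parity) → Fin n → Parity
pivoted   B X v r = mix (X r) (v r) ((B · v) r)
copivoted B X v r = mix (X r) ((B · v) r) (v r)

-- The set X is an indicator function, so that symmetric difference is pointwise addition.
Feasible : ∀ {n} → Matrix n → (Fin n → Parity) → Set
Feasible B X = ∀ v → (∀ r → pivoted B X v r ≡ 0ℙ) → ∀ r → v r ≡ 0ℙ

Feasible-cong : ∀ {n} (B : Matrix n) {X Y : Fin n → Parity} → X ≗ Y → Feasible B X → Feasible B Y
Feasible-cong B X≗Y feas v eq = feas v λ r →
  trans (cong (λ x → mix x (v r) ((B · v) r)) (X≗Y r)) (eq r)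

⊙-·-assoc : ∀ {m n} (u : Fin m → Parity) (K : Mat m n) y → u ⊙ (K · y) ≡ (λ i → u ⊙ (λ j → K j i)) ⊙ y
⊙-·-assoc u K y = begin
  sum (λ j → u j * K j ⊙ y)                   ≡⟨ sum-cong-≗ (λ j → *-⊙ (u j) (K j) y) ⟨
  sum (λ j → sum (λ i → u j * K j i * y i))   ≡⟨ ∑-comm (λ j i → u j * K j i * y i) ⟩
  sum (λ i → sum (λ j → u j * K j i * y i))   ≡⟨ sum-cong-≗ (λ i → *-distribʳ-sum (y i) (λ j → u j * K j i)) ⟨
  (λ i → u ⊙ (λ j → K j i)) ⊙ y               ∎
  where open ≡-Reasoning

submatrix : ∀ {k n} → Matrix n → (Fin k → Fin n) → Matrix k
submatrix B z i j = B (z i) (z j)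

module _ {k n} {z : Fin k → Fin n} {X : Fin n → Parity} (enum : Enumeration z X) (B : Matrix n) where
  open Enumeration enum

  private
    -- The inclusion of coordinates along z: it places entry i at position z i and 0 off X.
    scatter : Mat n k
    scatter j i = δ (z i) j

    ⊙-scatter : ∀ u w → u ⊙ (scatter · w) ≡ (u ∘ z) ⊙ w
    ⊙-scatter u w = trans (⊙-·-assoc u scatter w) (⊙-congʳ w λ i → ⊙-δ u (z i))

    scatter-z : ∀ w i → (scatter · w) (z i) ≡ w i
    scatter-z w i = trans (⊙-congʳ w eq) (sum-δ i w)
      where
      eq : ∀ j → δ (z j) (z i) ≡ δ i j
      eq j with j ≟ i
      ... | yes refl = trans (δ-refl (z j)) (sym (δ-refl j))
      ... | no j≢i   = trans (δ-≢ (j≢i ∘ injective j i)) (sym (δ-≢ (j≢i ∘ sym)))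

    scatter-off : ∀ w r → X r ≡ 0ℙ → (scatter · w) r ≡ 0ℙ
    scatter-off w r X≡0 = sum-zero λ i → cong (_* w i)
        (δ-≢ {i = z i} {r} λ eq → 0≢1 X≡0 (trans (cong X (sym eq)) (sound i)))

  -- A kernel vector of the submatrix, extended by zero, satisfies the equations for X.
  feasible⇒injective : Feasible B X → Injective (submatrix B z)
  feasible⇒injective feas w eq i = trans (sym (scatter-z w i)) (feas (scatter · w) pivoted≡0 (z i))
    where
    pivoted≡0 : ∀ r → pivoted B X (scatter · w) r ≡ 0ℙ
    pivoted≡0 r with X r in X≡
    ... | 0ℙ = scatter-off w r X≡
    ... | 1ℙ with complete r X≡
    ...   | i , refl = trans (⊙-scatter (B (z i)) w) (eq i)

  -- A solution of the equations vanishes off X, so it is the extension of its own restriction,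
  -- which the submatrix annihilates.
  injective⇒feasible : Injective (submatrix B z) → Feasible B X
  injective⇒feasible inj v eq r = trans (sym (v≗ r)) (⊙-zeroʳ (scatter r) w≡0)
    where
    w = v ∘ z
    off : ∀ r → X r ≡ 0ℙ → v r ≡ 0ℙ
    off r X≡0 = trans (sym (cong (λ x → mix x (v r) ((B · v) r)) X≡0)) (eq r)
    v≗ : ∀ r → (scatter · w) r ≡ v r
    v≗ r with X r in X≡
    ... | 0ℙ = trans (scatter-off w r X≡) (sym (off r X≡))
    ... | 1ℙ with complete r X≡
    ...   | i , refl = scatter-z w i
    w≡0 : ∀ i → w i ≡ 0ℙ
    w≡0 = inj w λ i → begin
      (B (z i) ∘ z) ⊙ w          ≡⟨ ⊙-scatter (B (z i)) w ⟨
      B (z i) ⊙ (scatter · w)    ≡⟨ ⊙-congˡ (B (z i)) v≗ ⟩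
      (B · v) (z i)              ≡⟨ cong (λ x → mix x (v (z i)) ((B · v) (z i))) (sound i) ⟨
      pivoted B X v (z i)        ≡⟨ eq (z i) ⟩
      0ℙ                         ∎
      where open ≡-Reasoning

  feasible⇒det≡1 : Feasible B X → det (submatrix B z) ≡ 1ℙ
  feasible⇒det≡1 feas = injective⇒det≡1 (submatrix B z) (feasible⇒injective feas)

  det≡1⇒feasible : det (submatrix B z) ≡ 1ℙ → Feasible B X
  det≡1⇒feasible det≡1 = injective⇒feasible (det≡1⇒injective (submatrix B z) det≡1)

-- Quadratic forms and the principal pivot transform.

self-adjoint : ∀ {n} (B : Matrix n) → Symmetric B → ∀ u v → u ⊙ (B · v) ≡ (B · u) ⊙ v
self-adjoint B sym-B u v = trans (⊙-·-assoc u B v) (⊙-congʳ v λ i →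
  trans (⊙-comm u (λ j → B j i)) (⊙-congʳ u λ j → sym-B j i))

diagonal : ∀ {n} → Matrix n → Fin n → Parity
diagonal B i = B i i

-- Off-diagonal entries contribute twice and cancel, and every element of ℤ₂ is its own square;
-- hence the form is linear in v.
quadratic-form : ∀ {n} (B : Matrix n) → Symmetric B → ∀ v → v ⊙ (B · v) ≡ diagonal B ⊙ v
quadratic-form {zero}  B sym-B v = refl
quadratic-form {suc n} B sym-B v = begin
  x * (b * x + r ⊙ w) + w ⊙ (λ i → B (suc i) zero * x + (B′ · w) i)
    ≡⟨ cong (x * (b * x + r ⊙ w) +_) (trans (⊙-congˡ w λ i →
         cong (_+ (B′ · w) i) (trans (cong (_* x) (sym-B (suc i) zero)) (Parity.*-comm (r i) x)))
         (⊙-+ w (λ i → x * r i) (B′ · w))) ⟩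
  x * (b * x + r ⊙ w) + (w ⊙ (λ i → x * r i) + w ⊙ (B′ · w))
    ≡⟨ cong₂ (λ c d → x * (b * x + r ⊙ w) + (c + d)) (trans (⊙-* x w r) (cong (x *_) (⊙-comm w r)))
         (quadratic-form B′ (λ i j → sym-B (suc i) (suc j)) w) ⟩
  x * (b * x + r ⊙ w) + (x * r ⊙ w + diagonal B′ ⊙ w)
    ≡⟨ arith x b (r ⊙ w) (diagonal B′ ⊙ w) ⟩
  b * x + diagonal B′ ⊙ w ∎
  where
  open ≡-Reasoning
  x = v zero
  b = B zero zero
  r = B zero ∘ suc
  w = v ∘ suc
  B′ : Matrix n
  B′ i j = B (suc i) (suc j)
  arith : ∀ x b c d → x * (b * x + c) + (x * c + d) ≡ b * x + d
  arith = from-yes (∀ℙ? λ x → ∀ℙ? λ b → ∀ℙ? λ c → ∀ℙ? λ d →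
    x * (b * x + c) + (x * c + d) Parity.≟ b * x + d)

-- D is the principal pivot transform of B at P.
record Pivot {n} (B : Matrix n) (P : Fin n → Parity) : Set where
  field
    D           : Matrix n
    symmetric   : Symmetric D
    D-pivoted   : ∀ v r → (D · pivoted B P v) r ≡ copivoted B P v r
    unpivot     : ∀ y → ∃ λ v → pivoted B P v ≗ y

mix-+ : ∀ x a b c d → mix x (a + c) (b + d) ≡ mix x a b + mix x c d
mix-+ 0ℙ a b c d = refl
mix-+ 1ℙ a b c d = refl

mix-0 : ∀ x {a b} → a ≡ 0ℙ → b ≡ 0ℙ → mix x a b ≡ 0ℙ
mix-0 0ℙ a≡0 _ = a≡0
mix-0 1ℙ _ b≡0 = b≡0

pivoted-+ : ∀ {n} (B : Matrix n) P u v r → pivoted B P (λ j → u j + v j) r ≡ pivoted B P u r + pivoted B P v r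
pivoted-+ B P u v r = trans (cong (mix (P r) (u r + v r)) (⊙-+ (B r) u v))
  (mix-+ (P r) (u r) ((B · u) r) (v r) ((B · v) r))

feasible-injective : ∀ {n} (B : Matrix n) {P : Fin n → Parity} → Feasible B P → ∀ {u v} →
    pivoted B P u ≗ pivoted B P v → u ≗ v
feasible-injective B {P} feas {u} {v} eq r = x+y≡0⇒x≡y (u r) (v r) (feas (λ j → u j + v j)
  (λ r → trans (pivoted-+ B P u v r) (trans (cong (_+ pivoted B P v r) (eq r)) (Parity.p+p≡0ℙ (pivoted B P v r)))) r)

-- The linear map from v to `pivoted B P v`, with matrix `T`, is injective by feasibility and hence
-- surjective. Column i of `D` is the copivoted image of a preimage `g i` of the i-th basis vector.
pivot-construction : ∀ {n} (B : Matrix n) → Symmetric B → ∀ {P} → Feasible B P → Pivot B P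
pivot-construction {n} B sym-B {P} feas = record
  { D         = D
  ; symmetric = λ i k → x+y≡0⇒x≡y (D i k) (D k i) (D-sym i k)
  ; D-pivoted = λ v r → trans (D· (pivoted B P v) r) (copivoted-cong
      (feasible-injective B feas (pivoted-G (pivoted B P v))) r)
  ; unpivot   = λ y → G · y , pivoted-G y
  }
  where
  open ≡-Reasoning
  T : Matrix n
  T r j = mix (P r) (δ r j) (B r j)
  T· : ∀ v r → (T · v) r ≡ pivoted B P v r
  T· v r with P r
  ... | 0ℙ = sum-δ r v
  ... | 1ℙ = refl
  preimage : ∀ i → ∃ λ v → ∀ r → (T · v) r ≡ δ i r
  preimage i = injective⇒surjective T (λ v eq → feas v λ r → trans (sym (T· v r)) (eq r)) (δ i)
  g : Fin n → Fin n → Parity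
  g i = proj₁ (preimage i)
  pivoted-g : ∀ i r → pivoted B P (g i) r ≡ δ i r
  pivoted-g i r = trans (sym (T· (g i) r)) (proj₂ (preimage i) r)
  G D : Matrix n
  G j i = g i j
  D r i = copivoted B P (g i) r
  D· : ∀ y r → (D · y) r ≡ copivoted B P (G · y) r
  D· y r with P r
  ... | 0ℙ = sym (⊙-·-assoc (B r) G y)
  ... | 1ℙ = refl
  pivoted-G : ∀ y r → pivoted B P (G · y) r ≡ y r
  pivoted-G y r = trans (expand (P r)) (trans (⊙-congʳ y (λ i → trans (pivoted-g i r) (δ-sym i r))) (sum-δ r y))
    where
    expand : ∀ x → mix x ((G · y) r) ((B · (G · y)) r) ≡ (λ i → mix x (g i r) ((B · g i) r)) ⊙ y
    expand 0ℙ = refl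
    expand 1ℙ = ⊙-·-assoc (B r) G y
  copivoted-cong : ∀ {u v} → u ≗ v → copivoted B P u ≗ copivoted B P v
  copivoted-cong u≗v r = cong₂ (mix (P r)) (⊙-congˡ (B r) u≗v) (u≗v r)
  -- In characteristic 2, exchanging coordinates of u with those of B u, and of v with those of B v,
  -- preserves u·Bv + Bu·v, which is 0 for symmetric B. At `g i` and `g k` this reads D i k + D k i
  -- = 0.
  form : ∀ u v → pivoted B P u ⊙ copivoted B P v + copivoted B P u ⊙ pivoted B P v ≡ 0ℙ
  form u v = begin
    pivoted B P u ⊙ copivoted B P v + copivoted B P u ⊙ pivoted B P v
      ≡⟨ ∑-distrib-+ (λ r → pivoted B P u r * copivoted B P v r) (λ r → copivoted B P u r * pivoted B P v r) ⟨
    sum (λ r → pivoted B P u r * copivoted B P v r + copivoted B P u r * pivoted B P v r)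
      ≡⟨ sum-cong-≗ (λ r → swap (P r) (u r) ((B · u) r) (v r) ((B · v) r)) ⟩
    sum (λ r → u r * (B · v) r + (B · u) r * v r)
      ≡⟨ ∑-distrib-+ (λ r → u r * (B · v) r) (λ r → (B · u) r * v r) ⟩
    u ⊙ (B · v) + (B · u) ⊙ v    ≡⟨ cong (_+ (B · u) ⊙ v) (self-adjoint B sym-B u v) ⟩
    (B · u) ⊙ v + (B · u) ⊙ v    ≡⟨ Parity.p+p≡0ℙ ((B · u) ⊙ v) ⟩
    0ℙ                           ∎
    where
    swap : ∀ x a b c d → mix x a b * mix x d c + mix x b a * mix x c d ≡ a * d + b * c
    swap 0ℙ a b c d = refl
    swap 1ℙ a b c d = Parity.+-comm (b * c) (a * d)
  D-sym : ∀ i k → D i k + D k i ≡ 0ℙ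
  D-sym i k = trans (cong₂ _+_
      (sym (trans (⊙-congʳ (copivoted B P (g k)) (pivoted-g i)) (sum-δ i (copivoted B P (g k)))))
      (sym (trans (⊙-congˡ (copivoted B P (g i)) (pivoted-g k)) (⊙-δ (copivoted B P (g i)) k))))
    (form (g i) (g k))

abstract
  pivot : ∀ {n} (B : Matrix n) → Symmetric B → ∀ {P} → Feasible B P → Pivot B P
  pivot = pivot-construction

module _ {n} {B : Matrix n} {P : Fin n → Parity} (piv : Pivot B P) where
  open Pivot piv

  -- Exchanging at P and then at X leaves exactly the indices of the symmetric difference exchanged.
  repivot : ∀ (X v : Fin n → Parity) r → mix (X r) (pivoted B P v r) ((D · pivoted B P v) r) ≡ pivoted B
      (λ i → X i + P i) v r
  repivot X v r = trans (cong (mix (X r) (pivoted B P v r)) (D-pivoted v r)) (flips (X r) (P r) (v r) ((B · v) r))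
    where
    flips : ∀ x y a b → mix x (mix y a b) (mix y b a) ≡ mix (x + y) a b
    flips 0ℙ 0ℙ a b = refl
    flips 0ℙ 1ℙ a b = refl
    flips 1ℙ 0ℙ a b = refl
    flips 1ℙ 1ℙ a b = refl

  -- By `repivot`, a solution y of the equations of D at X comes from a solution v of those of B at
  -- X + P.
  pivot-feasible : ∀ X → Feasible B (λ i → X i + P i) → Feasible D X
  pivot-feasible X feas y eq r with unpivot y
  ... | v , Tv≗y = trans (sym (Tv≗y r)) (mix-0 (P r) (v≡0 r) (⊙-zeroʳ (B r) v≡0))
    where
    v≡0 : ∀ r → v r ≡ 0ℙ
    v≡0 = feas v λ r → trans (sym (repivot X v r)) (trans (cong₂ (mix (X r)) (Tv≗y r) (⊙-congˡ (D r) Tv≗y)) (eq r))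

  pivot-feasible⁻¹ : Feasible B P → ∀ X → Feasible D X → Feasible B (λ i → X i + P i)
  pivot-feasible⁻¹ feas X feas-D v eq = feas v (feas-D (pivoted B P v) λ r → trans (repivot X v r) (eq r))

  -- Exchanging coordinates does not change the product of the two, so y·Dy = v·Bv; `quadratic-form`
  -- makes both sides linear.
  pivot-diagonal : Symmetric B → ∀ v → diagonal D ⊙ pivoted B P v ≡ diagonal B ⊙ v
  pivot-diagonal sym-B v = begin
    diagonal D ⊙ y       ≡⟨ quadratic-form D symmetric y ⟨
    y ⊙ (D · y)          ≡⟨ ⊙-congˡ y (D-pivoted v) ⟩
    y ⊙ copivoted B P v  ≡⟨ sum-cong-≗ (λ r → mix-* (P r) (v r) ((B · v) r)) ⟩
    v ⊙ (B · v)          ≡⟨ quadratic-form B sym-B v ⟩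
    diagonal B ⊙ v       ∎
    where
    open ≡-Reasoning
    y = pivoted B P v
    mix-* : ∀ x a b → mix x a b * mix x b a ≡ a * b
    mix-* 0ℙ a b = refl
    mix-* 1ℙ a b = Parity.*-comm b a

minor≡1⇒feasible : ∀ {n} (B : Matrix n) p → principalMinor B p ≡ 1ℙ → Feasible B (χ p)
minor≡1⇒feasible B p = det≡1⇒feasible (χ-enumeration p) B

feasible⇒minor≡1 : ∀ {n} (B : Matrix n) p → Feasible B (χ p) → principalMinor B p ≡ 1ℙ
feasible⇒minor≡1 B p = feasible⇒det≡1 (χ-enumeration p) B

-- Changing a subset at listed indices.

toggle : ∀ {n} → Subset n → Fin n → Subset n
toggle (b ∷ p) zero    = not b ∷ p
toggle (b ∷ p) (suc x) = b ∷ toggle p x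

χ-toggle : ∀ {n} (p : Subset n) x r → χ (toggle p x) r ≡ δ x r + χ p r
χ-toggle (true  ∷ p) zero    zero    = refl
χ-toggle (false ∷ p) zero    zero    = refl
χ-toggle (_     ∷ p) zero    (suc r) = refl
χ-toggle (true  ∷ p) (suc x) zero    = refl
χ-toggle (false ∷ p) (suc x) zero    = refl
χ-toggle (_     ∷ p) (suc x) (suc r) = χ-toggle p x r

∣toggle∣-∈ : ∀ {n} (p : Subset n) x → χ p x ≡ 1ℙ → suc ∣ toggle p x ∣ ≡ ∣ p ∣
∣toggle∣-∈ (true  ∷ p) zero    _  = refl
∣toggle∣-∈ (true  ∷ p) (suc x) eq = cong suc (∣toggle∣-∈ p x eq)
∣toggle∣-∈ (false ∷ p) (suc x) eq = ∣toggle∣-∈ p x eq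

∣toggle∣-∉ : ∀ {n} (p : Subset n) x → χ p x ≡ 0ℙ → ∣ toggle p x ∣ ≡ suc ∣ p ∣
∣toggle∣-∉ (false ∷ p) zero    _  = refl
∣toggle∣-∉ (true  ∷ p) (suc x) eq = cong suc (∣toggle∣-∉ p x eq)
∣toggle∣-∉ (false ∷ p) (suc x) eq = ∣toggle∣-∉ p x eq

-- An index listed twice cancels; for `Distinct` lists this is the indicator of the entries.
points : ∀ {n} → List (Fin n) → Fin n → Parity
points []       _ = 0ℙ
points (x ∷ xs) r = δ x r + points xs r

toggles : ∀ {n} → Subset n → List (Fin n) → Subset n
toggles p []       = p
toggles p (x ∷ xs) = toggle (toggles p xs) x

χ-toggles : ∀ {n} (p : Subset n) xs r → χ (toggles p xs) r ≡ points xs r + χ p r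
χ-toggles p []       r = refl
χ-toggles p (x ∷ xs) r = trans (χ-toggle (toggles p xs) x r) (trans (cong (δ x r +_) (χ-toggles p xs r))
  (sym (Parity.+-assoc (δ x r) (points xs r) (χ p r))))

Distinct : ∀ {n} → List (Fin n) → Set
Distinct []       = Unit
Distinct (x ∷ xs) = points xs x ≡ 0ℙ × Distinct xs

points-enumeration : ∀ {n} (xs : List (Fin n)) → Distinct xs → Enumeration (lookup xs) (points xs)
points-enumeration [] _ = record { injective = λ () ; sound = λ () ; complete = λ _ () }
points-enumeration (x ∷ xs) (x∉ , distinct) = record { injective = injective ; sound = sound ; complete = complete }
  where
  module E = Enumeration (points-enumeration xs distinct)
  fresh : ∀ i → lookup xs i ≢ x
  fresh i eq = 0≢1 x∉ (trans (cong (points xs) (sym eq)) (E.sound i))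
  injective : ∀ i j → lookup (x ∷ xs) i ≡ lookup (x ∷ xs) j → i ≡ j
  injective zero    zero    _  = refl
  injective zero    (suc j) eq = contradiction (sym eq) (fresh j)
  injective (suc i) zero    eq = contradiction eq (fresh i)
  injective (suc i) (suc j) eq = cong suc (E.injective i j eq)
  sound : ∀ i → points (x ∷ xs) (lookup (x ∷ xs) i) ≡ 1ℙ
  sound zero    = cong₂ _+_ (δ-refl x) x∉
  sound (suc i) = cong₂ _+_ (δ-≢ (fresh i ∘ sym)) (E.sound i)
  complete : ∀ r → points (x ∷ xs) r ≡ 1ℙ → ∃ λ i → lookup (x ∷ xs) i ≡ r
  complete r eq with x ≟ r
  ... | yes x≡r = zero , x≡r
  ... | no x≢r with E.complete r (trans (sym (cong (_+ points xs r) (δ-≢ x≢r))) eq)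
  ...   | i , refl = suc i , refl

-- Feasible sets of a symmetric matrix

∅-feasible : ∀ {n} (B : Matrix n) {X} → (∀ r → X r ≡ 0ℙ) → Feasible B X
∅-feasible B X≡0 v eq r = trans (sym (cong (λ x → mix x (v r) ((B · v) r)) (X≡0 r))) (eq r)

infeasible : ∀ {n} (B : Matrix n) {X : Fin n → Parity} v {s} → v s ≡ 1ℙ →
  (∀ r → X r ≡ 0ℙ → v r ≡ 0ℙ) → (∀ r → X r ≡ 1ℙ → (B · v) r ≡ 0ℙ) → ¬ Feasible B X
infeasible B {X} v {s} vs≡1 off on feas = 0≢1 (feas v pivoted≡0 s) vs≡1
  where
  pivoted≡0 : ∀ r → pivoted B X v r ≡ 0ℙ
  pivoted≡0 r with X r in X≡
  ... | 0ℙ = off r X≡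
  ... | 1ℙ = on r X≡

singleton-feasible : ∀ {n} (B : Matrix n) x → B x x ≡ 1ℙ → Feasible B (points (x ∷ []))
singleton-feasible B x Bxx≡1 = det≡1⇒feasible (points-enumeration (x ∷ []) (refl , tt)) B
  (cong (λ b → b * 1ℙ + 0ℙ) Bxx≡1)

singleton-feasible⁻¹ : ∀ {n} (B : Matrix n) x → Feasible B (points (x ∷ [])) → B x x ≡ 1ℙ
singleton-feasible⁻¹ B x feas = det₁ (B x x) (feasible⇒det≡1 (points-enumeration (x ∷ []) (refl , tt)) B feas)
  where
  det₁ : ∀ b → b * 1ℙ + 0ℙ ≡ 1ℙ → b ≡ 1ℙ
  det₁ 1ℙ _ = refl

-- For x ≢ y, nonsingularity of B[{x, y}].
Tight : ∀ {n} → Matrix n → Fin n → Fin n → Set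
Tight B x y = B x y ≡ 1ℙ + B x x * B y y

rows₂ : Parity → Parity → Parity → Matrix 2
rows₂ a b c = (a ◂ (b ◂ λ ())) ◂ ((b ◂ (c ◂ λ ())) ◂ λ ())

-- With diagonal a, c and off-diagonal entry b the determinant is ac + b² = ac + b.
pair-feasible⁻¹ : ∀ {n} (B : Matrix n) → Symmetric B → ∀ {x y} → x ≢ y →
  Feasible B (points (x ∷ y ∷ [])) → Tight B x y
pair-feasible⁻¹ B sym-B {x} {y} x≢y feas = det₂ (B x x) (B x y) (B y y) (trans (sym (det-cong entries))
  (feasible⇒det≡1 (points-enumeration (x ∷ y ∷ []) (cong (_+ 0ℙ) (δ-≢ (x≢y ∘ sym)) , refl , tt)) B feas))
  where
  entries : ∀ i j → submatrix B (lookup (x ∷ y ∷ [])) i j ≡ rows₂ (B x x) (B x y) (B y y) i j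
  entries zero       zero       = refl
  entries zero       (suc zero) = refl
  entries (suc zero) zero       = sym-B y x
  entries (suc zero) (suc zero) = refl
  det₂ : ∀ a b c → det (rows₂ a b c) ≡ 1ℙ → b ≡ 1ℙ + a * c
  det₂ = from-yes (∀ℙ? λ a → ∀ℙ? λ b → ∀ℙ? λ c → (det (rows₂ a b c) Parity.≟ 1ℙ) →-dec (b Parity.≟ 1ℙ + a * c))

-- In a symmetric determinant of order 3 the two 3-cycles cancel. The zeros at x and y leave only
-- the transposition of x and y, with product 1.
triple-feasible : ∀ {n} (B : Matrix n) → Symmetric B → ∀ {x y u} → x ≢ y → x ≢ u → y ≢ u →
  B x x ≡ 0ℙ → B y y ≡ 0ℙ → B x y ≡ 1ℙ → B u u ≡ 1ℙ → Feasible B (points (x ∷ y ∷ u ∷ []))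
triple-feasible B sym-B {x} {y} {u} x≢y x≢u y≢u Bxx Byy Bxy Buu = det≡1⇒feasible
  (points-enumeration (x ∷ y ∷ u ∷ []) (cong₂ (λ a b → a + (b + 0ℙ)) (δ-≢ (x≢y ∘ sym)) (δ-≢ (x≢u ∘ sym)) ,
      cong (_+ 0ℙ) (δ-≢ (y≢u ∘ sym)) , refl , tt)) B
  (trans (det-cong entries) (det₃ (B x u) (B y u)))
  where
  rows₃ : Parity → Parity → Matrix 3
  rows₃ a b = (0ℙ ◂ (1ℙ ◂ (a ◂ λ ()))) ◂ ((1ℙ ◂ (0ℙ ◂ (b ◂ λ ()))) ◂ ((a ◂ (b ◂ (1ℙ ◂ λ ()))) ◂ λ ()))
  entries : ∀ i j → submatrix B (lookup (x ∷ y ∷ u ∷ [])) i j ≡ rows₃ (B x u) (B y u) i j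
  entries zero             zero             = Bxx
  entries zero             (suc zero)       = Bxy
  entries zero             (suc (suc zero)) = refl
  entries (suc zero)       zero             = trans (sym-B y x) Bxy
  entries (suc zero)       (suc zero)       = Byy
  entries (suc zero)       (suc (suc zero)) = refl
  entries (suc (suc zero)) zero             = sym-B u x
  entries (suc (suc zero)) (suc zero)       = sym-B u y
  entries (suc (suc zero)) (suc (suc zero)) = Buu
  det₃ : ∀ a b → det (rows₃ a b) ≡ 1ℙ
  det₃ = from-yes (∀ℙ? λ a → ∀ℙ? λ b → det (rows₃ a b) Parity.≟ 1ℙ)

-- The tight cross entries are determined by the diagonal; the determinant is evaluated at all
-- values of the four diagonal entries and the two remaining ones.
quadruple-feasible⁻¹ : ∀ {n} (B : Matrix n) → Symmetric B → ∀ {x y u v} →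
  x ≢ y → x ≢ u → x ≢ v → y ≢ u → y ≢ v → u ≢ v →
  Tight B x u → Tight B x v → Tight B y u → Tight B y v →
  Feasible B (points (x ∷ y ∷ u ∷ v ∷ [])) → Tight B x y × Tight B u v
quadruple-feasible⁻¹ B sym-B {x} {y} {u} {v} x≢y x≢u x≢v y≢u y≢v u≢v Bxu Bxv Byu Byv feas =
  det₄ (B x x) (B y y) (B u u) (B v v) (B x y) (B u v) (trans (sym (det-cong entries))
    (feasible⇒det≡1 (points-enumeration (x ∷ y ∷ u ∷ v ∷ [])
      ( trans (cong₂ (λ a b → a + (b + _)) (δ-≢ (x≢y ∘ sym)) (δ-≢ (x≢u ∘ sym))) (cong (_+ 0ℙ) (δ-≢ (x≢v ∘ sym)))
      , cong₂ (λ a b → a + (b + 0ℙ)) (δ-≢ (y≢u ∘ sym)) (δ-≢ (y≢v ∘ sym)) , cong (_+ 0ℙ) (δ-≢ (u≢v ∘ sym)) , refl ,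
          tt)) B feas))
  where
  rows₄ : (a b c d e f : Parity) → Matrix 4
  rows₄ a b c d e f = (a ◂ (e ◂ (1ℙ + a * c ◂ (1ℙ + a * d ◂ λ ()))))
    ◂ ((e ◂ (b ◂ (1ℙ + b * c ◂ (1ℙ + b * d ◂ λ ()))))
    ◂ ((1ℙ + a * c ◂ (1ℙ + b * c ◂ (c ◂ (f ◂ λ ()))))
    ◂ ((1ℙ + a * d ◂ (1ℙ + b * d ◂ (f ◂ (d ◂ λ ()))))
    ◂ λ ())))
  entries : ∀ i j → submatrix B (lookup (x ∷ y ∷ u ∷ v ∷ [])) i j ≡ rows₄ (B x x) (B y y) (B u u) (B v v) (B x y)
      (B u v) i j
  entries zero zero = refl
  entries zero (suc zero) = refl
  entries zero (suc (suc zero)) = Bxu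
  entries zero (suc (suc (suc zero))) = Bxv
  entries (suc zero) zero = sym-B y x
  entries (suc zero) (suc zero) = refl
  entries (suc zero) (suc (suc zero)) = Byu
  entries (suc zero) (suc (suc (suc zero))) = Byv
  entries (suc (suc zero)) zero = trans (sym-B u x) Bxu
  entries (suc (suc zero)) (suc zero) = trans (sym-B u y) Byu
  entries (suc (suc zero)) (suc (suc zero)) = refl
  entries (suc (suc zero)) (suc (suc (suc zero))) = refl
  entries (suc (suc (suc zero))) zero = trans (sym-B v x) Bxv
  entries (suc (suc (suc zero))) (suc zero) = trans (sym-B v y) Byv
  entries (suc (suc (suc zero))) (suc (suc zero)) = sym-B v u
  entries (suc (suc (suc zero))) (suc (suc (suc zero))) = refl
  det₄ : ∀ a b c d e f → det (rows₄ a b c d e f) ≡ 1ℙ → (e ≡ 1ℙ + a * b) × (f ≡ 1ℙ + c * d)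
  det₄ = from-yes (∀ℙ? λ a → ∀ℙ? λ b → ∀ℙ? λ c → ∀ℙ? λ d → ∀ℙ? λ e → ∀ℙ? λ f →
    (det (rows₄ a b c d e f) Parity.≟ 1ℙ) →-dec ((e Parity.≟ 1ℙ + a * b) ×-dec (f Parity.≟ 1ℙ + c * d)))

-- epr-sequences over ℤ₂

χ-⊤-size : ∀ {n} (p : Subset n) → ∣ p ∣ ≡ n → ∀ r → χ p r ≡ 1ℙ
χ-⊤-size (true  ∷ p) eq zero    = refl
χ-⊤-size (true  ∷ p) eq (suc r) = χ-⊤-size p (ℕ.suc-injective eq) r
χ-⊤-size (false ∷ p) eq r       = contradiction (∣p∣≤n p) (ℕ.<⇒≱ (ℕ.≤-reflexive (sym eq)))

χ-⊤ : ∀ {n} (r : Fin n) → χ ⊤ r ≡ 1ℙ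
χ-⊤ {n} = χ-⊤-size ⊤ (∣⊤∣≡n n)

subset-of-size : ∀ {n} (p : Subset n) {k} → k ≤ ∣ p ∣ → ∃ λ q → ∣ q ∣ ≡ k × (∀ r → χ p r ≡ 0ℙ → χ q r ≡ 0ℙ)
subset-of-size []          z≤n = [] , refl , λ ()
subset-of-size (false ∷ p) k≤  with subset-of-size p k≤
... | q , size , q⊆p = false ∷ q , size , λ { zero _ → refl ; (suc r) → q⊆p r }
subset-of-size (true  ∷ p) {zero} _ with subset-of-size p {zero} z≤n
... | q , size , q⊆p = false ∷ q , size , λ { (suc r) → q⊆p r }
subset-of-size (true  ∷ p) {suc k} (s≤s k≤) with subset-of-size p k≤
... | q , size , q⊆p = true ∷ q , cong suc size , λ { (suc r) → q⊆p r }

size-k : ∀ {n k} → k ≤ n → ∃ λ (q : Subset n) → ∣ q ∣ ≡ k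
size-k {n} k≤n with subset-of-size ⊤ (subst (_ ≤_) (sym (∣⊤∣≡n n)) k≤n)
... | q , size , _ = q , size

suc-odd : ∀ k → parity k ≡ 0ℙ → parity (suc k) ≡ 1ℙ
suc-odd k even = trans (sym (Parity.suc-homo-⁻¹ (suc k))) (cong _⁻¹ even)

sum-χ : ∀ {n} (p : Subset n) → sum (χ p) ≡ parity ∣ p ∣
sum-χ []          = refl
sum-χ (true  ∷ p) = trans (cong (1ℙ +_) (sum-χ p)) (Parity.suc-homo-⁻¹ (suc ∣ p ∣))
sum-χ (false ∷ p) = sum-χ p

nonempty : ∀ {n k} (p : Subset n) → ∣ p ∣ ≡ suc k → ∃ λ x → χ p x ≡ 1ℙ
nonempty (true  ∷ p) _    = zero , refl
nonempty (false ∷ p) size with nonempty p size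
... | x , x∈p = suc x , x∈p

empty : ∀ {n} (p : Subset n) → ∣ p ∣ ≡ 0 → ∀ r → χ p r ≡ 0ℙ
empty (false ∷ p) size zero    = refl
empty (false ∷ p) size (suc r) = empty p size r

size-1 : ∀ {n} (p : Subset n) → ∣ p ∣ ≡ 1 → ∃ λ x → χ p ≗ points (x ∷ [])
size-1 p size with nonempty p size
... | x , x∈p = x , λ r → x+y≡0⇒x≡y (χ p r) (points (x ∷ []) r)
      (trans (swap (χ p r) (δ x r)) (trans (sym (χ-toggle p x r))
    (empty (toggle p x) (ℕ.suc-injective (trans (∣toggle∣-∈ p x x∈p) size)) r)))
  where
  swap : ∀ a b → a + (b + 0ℙ) ≡ b + a
  swap a b = trans (cong (a +_) (Parity.+-identityʳ b)) (Parity.+-comm a b)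

module _ {n} (B : Matrix n) where

  AllZero⇒infeasible : ∀ {k} → AllZero B k → ∀ p → ∣ p ∣ ≡ k → ¬ Feasible B (χ p)
  AllZero⇒infeasible all0 p size feas = 0≢1 (all0 p size) (feasible⇒minor≡1 B p feas)

  AllNonzero⇒feasible : ∀ {k} → AllNonzero B k → ∀ p → ∣ p ∣ ≡ k → Feasible B (χ p)
  AllNonzero⇒feasible all p size = minor≡1⇒feasible B p (≢0⇒≡1 (all p size))

  SomeNonzero₁⇒loop : SomeNonzero B 1 → ∃ λ u → B u u ≡ 1ℙ
  SomeNonzero₁⇒loop (p , size , minor≢0) with size-1 p size
  ... | u , χ≗ = u , singleton-feasible⁻¹ B u (Feasible-cong B χ≗ (minor≡1⇒feasible B p (≢0⇒≡1 minor≢0)))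

  ¬AllNonzero₁⇒loopless : ¬ AllNonzero B 1 → ∃ λ w → B w w ≡ 0ℙ
  ¬AllNonzero₁⇒loopless ¬all with any? (λ w → B w w Parity.≟ 0ℙ)
  ... | yes w = w
  ... | no ∄w = contradiction case ¬all
    where
    case : ∀ p → ∣ p ∣ ≡ 1 → principalMinor B p ≢ 0ℙ
    case p size minor≡0 with size-1 p size
    ... | u , χ≗ = 0≢1 minor≡0 (feasible⇒minor≡1 B p (Feasible-cong B (sym ∘ χ≗)
          (singleton-feasible B u (≢0⇒≡1 (λ eq → ∄w (u , eq))))))

  -- A feasible p of order k + 2 would give a pivot D for which no set X with X Δ p of order k + 1
  -- is feasible. Suitable X of one and three elements force D to vanish on p.
  AllZero-suc : Symmetric B → ∀ {u} → B u u ≡ 1ℙ → ∀ {k} → AllZero B (suc k) → AllZero B (suc (suc k))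
  AllZero-suc sym-B {u} Buu≡1 {k} all0 p size = ≢1⇒≡0 impossible
    where
    no-feasible : ∀ q → ∣ q ∣ ≡ suc k → ¬ Feasible B (χ q)
    no-feasible = AllZero⇒infeasible all0
    impossible : principalMinor B p ≢ 1ℙ
    impossible minor≡1 with nonempty p size
    -- The basis vector at x then shows p infeasible for D.
    ... | x , x∈p = infeasible D (δ x) (δ-refl x) (λ r r∉p → δ-≢ (separate x∈p r∉p))
            (λ r r∈p → trans (⊙-δ (D r) x) (D≡0 r x r∈p x∈p)) p-feasible-D
      where
      feas : Feasible B (χ p)
      feas = minor≡1⇒feasible B p minor≡1
      piv = pivot B sym-B feas
      open Pivot piv
      separate : ∀ {x y} → χ p x ≡ 1ℙ → χ p y ≡ 0ℙ → x ≢ y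
      separate x∈p y∉p refl = 0≢1 y∉p x∈p
      toggled : ∀ xs → Feasible D (points xs) → Feasible B (χ (toggles p xs))
      toggled xs f = Feasible-cong B (λ r → sym (χ-toggles p xs r)) (pivot-feasible⁻¹ piv feas (points xs) f)
      -- The shift of p by p is the empty set.
      p-feasible-D : Feasible D (χ p)
      p-feasible-D = pivot-feasible piv (χ p) (∅-feasible B λ r → Parity.p+p≡0ℙ (χ p r))
      D-diagonal : ∀ r → χ p r ≡ 1ℙ → D r r ≡ 0ℙ
      D-diagonal r r∈p = ≢1⇒≡0 λ Drr≡1 → no-feasible (toggle p r)
        (ℕ.suc-injective (trans (∣toggle∣-∈ p r r∈p) size)) (toggled (r ∷ []) (singleton-feasible D r Drr≡1))
      diagonal-transfer : ∀ r → B r r ≡ diagonal D ⊙ pivoted B (χ p) (δ r)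
      diagonal-transfer r = sym (trans (pivot-diagonal piv sym-B (δ r)) (⊙-δ (diagonal B) r))
      -- `pivoted` changes coordinates only on p, where D has zero diagonal, so `pivot-diagonal`
      -- equates the diagonals of B and D.
      off-p : ∀ r s → D s s * pivoted B (χ p) (δ r) s ≡ D s s * δ r s
      off-p r s with χ p s in s∈?p
      ... | 0ℙ = refl
      ... | 1ℙ = trans (cong (_* (B · δ r) s) (D-diagonal s s∈?p)) (sym (cong (_* δ r s) (D-diagonal s s∈?p)))
      B≡D : ∀ r → B r r ≡ D r r
      B≡D r = trans (diagonal-transfer r) (trans (sum-cong-≗ (off-p r)) (⊙-δ (diagonal D) r))
      Duu≡1 : D u u ≡ 1ℙ
      Duu≡1 = trans (sym (B≡D u)) Buu≡1
      u∉p : χ p u ≡ 0ℙ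
      u∉p = ≢1⇒≡0 λ u∈p → 0≢1 (D-diagonal u u∈p) Duu≡1
      D≡0 : ∀ r s → χ p r ≡ 1ℙ → χ p s ≡ 1ℙ → D r s ≡ 0ℙ
      D≡0 r s r∈p s∈p with r ≟ s
      ... | yes refl = D-diagonal r r∈p
      -- An entry 1 would make the set of r, s and u feasible for D. Shifted by p, it removes r and
      -- s and adds u, which gives order k + 1.
      ... | no r≢s   = ≢1⇒≡0 λ Drs≡1 → no-feasible (toggles p (r ∷ s ∷ u ∷ [])) size′
              (toggled (r ∷ s ∷ u ∷ []) (triple-feasible D symmetric r≢s (separate r∈p u∉p) (separate s∈p u∉p)
                (D-diagonal r r∈p) (D-diagonal s s∈p) Drs≡1 Duu≡1))
        where
        s∈ : χ (toggles p (u ∷ [])) s ≡ 1ℙ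
        s∈ = trans (χ-toggles p (u ∷ []) s) (cong₂ (λ a b → a + 0ℙ + b) (δ-≢ (separate s∈p u∉p ∘ sym)) s∈p)
        r∈ : χ (toggles p (s ∷ u ∷ [])) r ≡ 1ℙ
        r∈ = trans (χ-toggles p (s ∷ u ∷ []) r) (trans (cong₂ (λ a b → a + (b + 0ℙ) + χ p r)
               (δ-≢ (r≢s ∘ sym)) (δ-≢ (separate r∈p u∉p ∘ sym))) r∈p)
        size′ : ∣ toggles p (r ∷ s ∷ u ∷ []) ∣ ≡ suc k
        size′ = ℕ.suc-injective (ℕ.suc-injective (begin
          suc (suc ∣ toggles p (r ∷ s ∷ u ∷ []) ∣) ≡⟨ cong suc (∣toggle∣-∈ (toggles p (s ∷ u ∷ [])) r r∈) ⟩
          suc ∣ toggles p (s ∷ u ∷ []) ∣           ≡⟨ ∣toggle∣-∈ (toggle p u) s s∈ ⟩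
          ∣ toggle p u ∣                           ≡⟨ ∣toggle∣-∉ p u u∉p ⟩
          suc ∣ p ∣                                ≡⟨ cong suc size ⟩
          suc (suc (suc k))                        ∎))
          where open ≡-Reasoning

-- Tight matrices.

points-∷ : ∀ {n} {x y : Fin n} xs → y ≢ x → points xs x ≡ 0ℙ → points (y ∷ xs) x ≡ 0ℙ
points-∷ xs y≢x x∉xs = cong₂ _+_ (δ-≢ y≢x) x∉xs

χ-toggles-fresh : ∀ {n} (p : Subset n) xs {x} → points xs x ≡ 0ℙ → χ (toggles p xs) x ≡ χ p x
χ-toggles-fresh p xs {x} x∉xs = trans (χ-toggles p xs x) (cong (_+ χ p x) x∉xs)

TightMatrix : ∀ {n} → Matrix n → Set
TightMatrix B = ∀ x y → x ≢ y → Tight B x y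

Tight-sym : ∀ {n} (B : Matrix n) → Symmetric B → ∀ {x y} → Tight B x y → Tight B y x
Tight-sym B sym-B {x} {y} tight = trans (sym-B y x) (trans tight (cong (1ℙ +_) (Parity.*-comm (B x x) (B y y))))

sum-δ-1 : ∀ {n} (x : Fin n) → sum (δ x) ≡ 1ℙ
sum-δ-1 x = trans (sym (sum-cong-≗ λ j → Parity.*-identityʳ (δ x j))) (sum-δ x (const 1ℙ))

sum-points : ∀ {n} (xs : List (Fin n)) → sum (points xs) ≡ parity (length xs)
sum-points {n} []   = sum-replicate-zero n
sum-points (x ∷ xs) = trans (∑-distrib-+ (δ x) (points xs))
  (trans (cong₂ _+_ (sum-δ-1 x) (sum-points xs)) (Parity.suc-homo-⁻¹ (suc (length xs))))

module _ {n k} (B : Matrix n) (sym-B : Symmetric B) (all : AllNonzero B k)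
  {p : Subset n} (∣p∣≡k : ∣ p ∣ ≡ k) (piv : Pivot B (χ p)) where
  open Pivot piv
  private
    separate : ∀ {x y} → χ p x ≡ 1ℙ → χ p y ≡ 0ℙ → x ≢ y
    separate x∈p y∉p refl = 0≢1 y∉p x∈p
    feasible-D : ∀ xs → ∣ toggles p xs ∣ ≡ ∣ p ∣ → Feasible D (points xs)
    feasible-D xs size = pivot-feasible piv (points xs) (Feasible-cong B (χ-toggles p xs)
      (AllNonzero⇒feasible B all (toggles p xs) (trans size ∣p∣≡k)))

    -- Replacing x in p by y keeps the order k, so the pair is feasible for D.
    tight-across : ∀ {x y} → χ p x ≡ 1ℙ → χ p y ≡ 0ℙ → Tight D x y
    tight-across {x} {y} x∈p y∉p = pair-feasible⁻¹ D symmetric (separate x∈p y∉p) (feasible-D (x ∷ y ∷ [])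
      (ℕ.suc-injective (trans (∣toggle∣-∈ (toggle p y) x
        (trans (χ-toggles-fresh p (y ∷ []) (points-∷ [] (separate x∈p y∉p ∘ sym) refl)) x∈p)) (∣toggle∣-∉ p y y∉p))))

    -- Replacing x, y in p by u, v keeps the order k; the four cross pairs are already tight.
    tight-both : ∀ {x y u v} → x ≢ y → u ≢ v → χ p x ≡ 1ℙ → χ p y ≡ 1ℙ → χ p u ≡ 0ℙ → χ p v ≡ 0ℙ →
      Tight D x y × Tight D u v
    tight-both {x} {y} {u} {v} x≢y u≢v x∈p y∈p u∉p v∉p = quadruple-feasible⁻¹ D symmetric x≢y
      (separate x∈p u∉p) (separate x∈p v∉p) (separate y∈p u∉p) (separate y∈p v∉p) u≢v
      (tight-across x∈p u∉p) (tight-across x∈p v∉p) (tight-across y∈p u∉p) (tight-across y∈p v∉p)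
      (feasible-D (x ∷ y ∷ u ∷ v ∷ []) (ℕ.suc-injective (ℕ.suc-injective (begin
        suc (suc ∣ toggles p (x ∷ y ∷ u ∷ v ∷ []) ∣) ≡⟨ cong suc (∣toggle∣-∈ (toggles p (y ∷ u ∷ v ∷ [])) x x∈) ⟩
        suc ∣ toggles p (y ∷ u ∷ v ∷ []) ∣           ≡⟨ ∣toggle∣-∈ (toggles p (u ∷ v ∷ [])) y y∈ ⟩
        ∣ toggles p (u ∷ v ∷ []) ∣                   ≡⟨ ∣toggle∣-∉ (toggle p v) u u∉ ⟩
        suc ∣ toggle p v ∣                           ≡⟨ cong suc (∣toggle∣-∉ p v v∉p) ⟩
        suc (suc ∣ p ∣)                              ∎))))
      where
      open ≡-Reasoning
      u∉ = trans (χ-toggles-fresh p (v ∷ []) {u} (points-∷ [] (u≢v ∘ sym) refl)) u∉p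
      y∈ = trans (χ-toggles-fresh p (u ∷ v ∷ []) {y} (points-∷ (v ∷ []) (separate y∈p u∉p ∘ sym)
             (points-∷ [] (separate y∈p v∉p ∘ sym) refl))) y∈p
      x∈ = trans (χ-toggles-fresh p (y ∷ u ∷ v ∷ []) {x} (points-∷ (u ∷ v ∷ []) (x≢y ∘ sym)
             (points-∷ (v ∷ []) (separate x∈p u∉p ∘ sym) (points-∷ [] (separate x∈p v∉p ∘ sym) refl)))) x∈p

  -- A pair inside p is matched with the outer pair u, v, and a pair outside p with the inner pair
  -- x, y.
  pivot-tight : ∀ {x y u v} → x ≢ y → u ≢ v → χ p x ≡ 1ℙ → χ p y ≡ 1ℙ → χ p u ≡ 0ℙ → χ p v ≡ 0ℙ → TightMatrix D
  pivot-tight x≢y u≢v x∈p y∈p u∉p v∉p r s r≢s with χ p r in r∈? | χ p s in s∈?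
  ... | 1ℙ | 0ℙ = tight-across r∈? s∈?
  ... | 0ℙ | 1ℙ = Tight-sym D symmetric (tight-across s∈? r∈?)
  ... | 1ℙ | 1ℙ = proj₁ (tight-both r≢s u≢v r∈? s∈? u∉p v∉p)
  ... | 0ℙ | 0ℙ = proj₂ (tight-both x≢y r≢s x∈p y∈p r∈? s∈?)

-- A tight matrix is J + d dᵀ + I with d its diagonal.
module _ {n} (B : Matrix n) (tight : TightMatrix B) where
  private
    d = diagonal B

  tight-· : ∀ v r → (B · v) r ≡ sum v + d r * d ⊙ v + v r
  tight-· v r = begin
    B r ⊙ v                                        ≡⟨ ⊙-congʳ v entry ⟩
    (λ s → 1ℙ + d r * d s + δ r s) ⊙ v             ≡⟨ +-⊙ (λ s → 1ℙ + d r * d s) (δ r) v ⟩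
    (λ s → 1ℙ + d r * d s) ⊙ v + δ r ⊙ v           ≡⟨ cong₂ _+_ (+-⊙ (const 1ℙ) (λ s → d r * d s) v) (sum-δ r v) ⟩
    sum v + (λ s → d r * d s) ⊙ v + v r            ≡⟨ cong (λ a → sum v + a + v r) (*-⊙ (d r) d v) ⟩
    sum v + d r * d ⊙ v + v r                      ∎
    where
    open ≡-Reasoning
    entry : ∀ s → B r s ≡ 1ℙ + d r * d s + δ r s
    entry s with r ≟ s
    ... | yes refl = trans (idem (d r)) (cong (1ℙ + d r * d r +_) (sym (δ-refl r)))
      where
      idem : ∀ a → a ≡ 1ℙ + a * a + 1ℙ
      idem 0ℙ = refl
      idem 1ℙ = refl
    ... | no r≢s   = trans (tight r s r≢s) (trans (sym (Parity.+-identityʳ _))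
          (cong (1ℙ + d r * d s +_) (sym (δ-≢ r≢s))))

  -- By `tight-·`, a solution v is determined by σ = sum v and l = d·v. Summing its entries, plain
  -- and weighted by d, gives two linear equations for σ and l, which have only the zero solution
  -- under the condition on X.
  tight-feasible : ∀ X → sum X * (1ℙ + d ⊙ X) ≡ 0ℙ → Feasible B X
  tight-feasible X cond v eq r = trans (v≡ r) (trans
    (cong₂ (λ a b → X r * (a + d r * b)) (proj₁ σ,λ≡0) (proj₂ σ,λ≡0))
        (trans (cong (X r *_) (Parity.*-zeroʳ (d r))) (Parity.*-zeroʳ (X r))))
    where
    open ≡-Reasoning
    σ = sum v
    l = d ⊙ v
    v≡ : ∀ r → v r ≡ X r * (σ + d r * l)
    v≡ r with X r | eq r
    ... | 0ℙ | vr≡0  = vr≡0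
    ... | 1ℙ | Bvr≡0 = sym (x+y≡0⇒x≡y (σ + d r * l) (v r) (trans (sym (tight-· v r)) Bvr≡0))
    σ≡ : σ ≡ sum X * σ + d ⊙ X * l
    σ≡ = begin
      sum v                                           ≡⟨ sum-cong-≗ (λ r → trans (v≡ r) (expand (X r) σ (d r) l)) ⟩
      sum (λ r → X r * σ + d r * X r * l)             ≡⟨ ∑-distrib-+ (λ r → X r * σ) (λ r → d r * X r * l) ⟩
      sum (λ r → X r * σ) + sum (λ r → d r * X r * l) ≡⟨ cong₂ _+_ (*-distribʳ-sum σ X)
          (*-distribʳ-sum l (λ r → d r * X r)) ⟨
      sum X * σ + d ⊙ X * l                           ∎
      where
      expand : ∀ x a b c → x * (a + b * c) ≡ x * a + b * x * c
      expand = from-yes (∀ℙ? λ x → ∀ℙ? λ a → ∀ℙ? λ b → ∀ℙ? λ c → x * (a + b * c) Parity.≟ x * a + b * x * c)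
    l≡ : l ≡ d ⊙ X * σ + d ⊙ X * l
    l≡ = begin
      d ⊙ v                                           ≡⟨
          sum-cong-≗ (λ r → trans (cong (d r *_) (v≡ r)) (expand (X r) σ (d r) l)) ⟩
      sum (λ r → d r * X r * σ + d r * X r * l)       ≡⟨ ∑-distrib-+ (λ r → d r * X r * σ) (λ r → d r * X r * l) ⟩
      sum (λ r → d r * X r * σ) + sum (λ r → d r * X r * l) ≡⟨ cong₂ _+_ (*-distribʳ-sum σ (λ r → d r * X r))
          (*-distribʳ-sum l (λ r → d r * X r)) ⟨
      d ⊙ X * σ + d ⊙ X * l                           ∎
      where
      expand : ∀ x a b c → b * (x * (a + b * c)) ≡ b * x * a + b * x * c
      expand = from-yes (∀ℙ? λ x → ∀ℙ? λ a → ∀ℙ? λ b → ∀ℙ? λ c → b * (x * (a + b * c)) Parity.≟ b * x * a + b * x * c)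
    solve : ∀ π e σ l → π * (1ℙ + e) ≡ 0ℙ → σ ≡ π * σ + e * l → l ≡ e * σ + e * l → (σ ≡ 0ℙ) × (l ≡ 0ℙ)
    solve = from-yes (∀ℙ? λ π → ∀ℙ? λ e → ∀ℙ? λ σ → ∀ℙ? λ l →
      (π * (1ℙ + e) Parity.≟ 0ℙ) →-dec ((σ Parity.≟ π * σ + e * l) →-dec ((l Parity.≟ e * σ + e * l) →-dec
        ((σ Parity.≟ 0ℙ) ×-dec (l Parity.≟ 0ℙ)))))
    σ,λ≡0 = solve (sum X) (d ⊙ X) σ l cond σ≡ l≡

  -- The indicator of X is itself the offending vector: on X its image is 1 + 0 + 1.
  tight-infeasible : ∀ X → sum X ≡ 1ℙ → d ⊙ X ≡ 0ℙ → ¬ Feasible B X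
  tight-infeasible X odd loops-even with any? (λ r → X r Parity.≟ 1ℙ)
  ... | no ∄1 = contradiction odd (0≢1 (sum-zero λ r → ≢1⇒≡0 λ eq → ∄1 (r , eq)))
  ... | yes (s , Xs≡1) = infeasible B X Xs≡1 (λ r eq → eq) λ r Xr≡1 → trans (tight-· X r) (trans
        (cong₂ (λ a b → a + d r * b + X r) odd loops-even)
        (trans (cong₂ (λ a b → 1ℙ + a + b) (Parity.*-zeroʳ (d r)) Xr≡1) refl))

-- Every even set is feasible for the tight pivot D at p, hence every set of the parity of p is feasible for B.
module _ {n} (B : Matrix n) (sym-B : Symmetric B) {p : Subset n} (feas : Feasible B (χ p)) (piv : Pivot B (χ p)) where
  open Pivot piv

  pivot-tight⁻¹ : TightMatrix D → ∀ {w} → B w w ≡ 0ℙ → TightMatrix B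
  pivot-tight⁻¹ tight {w} Bww≡0 = go (sum (χ p)) refl
    where
    same-parity : ∀ X → sum X ≡ sum (χ p) → Feasible B X
    same-parity X eq = Feasible-cong B (λ r → trans (Parity.+-assoc (X r) (χ p r) (χ p r))
        (trans (cong (X r +_) (Parity.p+p≡0ℙ (χ p r))) (Parity.+-identityʳ (X r))))
      (pivot-feasible⁻¹ piv feas X+p (tight-feasible D tight X+p
        (cong (_* (1ℙ + diagonal D ⊙ X+p)) (trans (∑-distrib-+ X (χ p))
          (trans (cong (_+ sum (χ p)) eq) (Parity.p+p≡0ℙ (sum (χ p))))))))
      where
      X+p : Fin n → Parity
      X+p r = X r + χ p r
    go : ∀ b → sum (χ p) ≡ b → TightMatrix B
    go 0ℙ even x y x≢y = pair-feasible⁻¹ B sym-B x≢y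
      (same-parity (points (x ∷ y ∷ [])) (trans (sum-points (x ∷ y ∷ [])) (sym even)))
    -- For odd p singletons would be feasible, against the zero at w.
    go 1ℙ odd = contradiction (singleton-feasible⁻¹ B w
      (same-parity (points (w ∷ [])) (trans (sum-points (w ∷ [])) (sym odd)))) (0≢1 Bww≡0)

-- The bound on k leaves room for p to contain indices 0 and 1 and omit 2 and 3, the two inner and
-- two outer indices that `pivot-tight` asks for.
AllNonzero⇒tight : ∀ {m k} (B : Matrix (4 ℕ.+ m)) → Symmetric B → k ≤ m → AllNonzero B (2 ℕ.+ k) →
  ∀ {w} → B w w ≡ 0ℙ → TightMatrix B
AllNonzero⇒tight {m} {k} B sym-B k≤m all Bww≡0 with size-k k≤m
... | q , ∣q∣≡k = pivot-tight⁻¹ B sym-B {p} feas piv (pivot-tight B sym-B all {p} ∣p∣≡ piv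
      {zero} {suc zero} {suc (suc zero)} {suc (suc (suc zero))} (λ ()) (λ ()) refl refl refl refl) Bww≡0
  where
  p : Subset (4 ℕ.+ m)
  p = true ∷ true ∷ false ∷ false ∷ q
  ∣p∣≡ : ∣ p ∣ ≡ 2 ℕ.+ k
  ∣p∣≡ = cong (2 ℕ.+_) ∣q∣≡k
  feas : Feasible B (χ p)
  feas = AllNonzero⇒feasible B all p ∣p∣≡
  piv : Pivot B (χ p)
  piv = pivot B sym-B feas

module _ {n} (B : Matrix n) (tight : TightMatrix B) where
  private
    d = diagonal B

  tight-even : ∀ {k} → parity k ≡ 0ℙ → AllNonzero B k
  tight-even even p size minor≡0 = 0≢1 minor≡0 (feasible⇒minor≡1 B p (tight-feasible B tight (χ p)
    (cong (_* (1ℙ + d ⊙ χ p)) (trans (sum-χ p) (trans (cong parity size) even)))))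

  -- Take q of order one less avoiding u and w. Adding u or w yields different parities of the
  -- number of nonzero diagonal entries, hence one feasible and one infeasible set.
  tight-odd : ∀ {u w} → B u u ≡ 1ℙ → B w w ≡ 0ℙ → ∀ {k} → parity k ≡ 1ℙ → k < n → HasSymbol B k S
  tight-odd {u} {w} Buu≡1 Bww≡0 {suc k} odd k<n with subset-of-size (toggles ⊤ (u ∷ w ∷ [])) {k} k≤
    where
    w≢u : w ≢ u
    w≢u refl = 0≢1 Bww≡0 Buu≡1
    u∈ : χ (toggle ⊤ w) u ≡ 1ℙ
    u∈ = trans (χ-toggles-fresh ⊤ (w ∷ []) (points-∷ [] w≢u refl)) (χ-⊤ u)
    ∣toggles∣ : suc (suc ∣ toggles ⊤ (u ∷ w ∷ []) ∣) ≡ n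
    ∣toggles∣ = trans (cong suc (∣toggle∣-∈ (toggle ⊤ w) u u∈)) (trans (∣toggle∣-∈ ⊤ w (χ-⊤ w)) (∣⊤∣≡n n))
    k≤ : k ≤ ∣ toggles ⊤ (u ∷ w ∷ []) ∣
    k≤ = ℕ.≤-pred (ℕ.≤-pred (ℕ.≤-trans k<n (ℕ.≤-reflexive (sym ∣toggles∣))))
  ... | q , ∣q∣≡k , q⊆ = go (d ⊙ χ q) refl
    where
    u≢w : u ≢ w
    u≢w refl = 0≢1 Bww≡0 Buu≡1
    u∉q : χ q u ≡ 0ℙ
    u∉q = q⊆ u (trans (χ-toggles ⊤ (u ∷ w ∷ []) u)
      (cong₂ _+_ (cong₂ (λ a b → a + (b + 0ℙ)) (δ-refl u) (δ-≢ (u≢w ∘ sym))) (χ-⊤ u)))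
    w∉q : χ q w ≡ 0ℙ
    w∉q = q⊆ w (trans (χ-toggles ⊤ (u ∷ w ∷ []) w)
      (cong₂ _+_ (cong₂ (λ a b → a + (b + 0ℙ)) (δ-≢ u≢w) (δ-refl w)) (χ-⊤ w)))
    size : ∀ x → χ q x ≡ 0ℙ → ∣ toggle q x ∣ ≡ suc k
    size x x∉q = trans (∣toggle∣-∉ q x x∉q) (cong suc ∣q∣≡k)
    loops : ∀ x → d ⊙ χ (toggle q x) ≡ d x + d ⊙ χ q
    loops x = trans (⊙-congˡ d (χ-toggle q x)) (trans (⊙-+ d (δ x) (χ q)) (cong (_+ d ⊙ χ q) (⊙-δ d x)))
    some : ∀ x → χ q x ≡ 0ℙ → d x + d ⊙ χ q ≡ 1ℙ → SomeNonzero B (suc k)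
    some x x∉q eq = toggle q x , size x x∉q , λ minor≡0 → 0≢1 minor≡0 (feasible⇒minor≡1 B (toggle q x)
      (tight-feasible B tight (χ (toggle q x))
          (trans (cong (λ a → sum (χ (toggle q x)) * (1ℙ + a)) (trans (loops x) eq))
          (Parity.*-zeroʳ (sum (χ (toggle q x)))))))
    not-all : ∀ x → χ q x ≡ 0ℙ → d x + d ⊙ χ q ≡ 0ℙ → ¬ AllNonzero B (suc k)
    not-all x x∉q eq all = tight-infeasible B tight (χ (toggle q x))
        (trans (sum-χ (toggle q x)) (trans (cong parity (size x x∉q)) odd))
      (trans (loops x) eq) (minor≡1⇒feasible B (toggle q x) (≢0⇒≡1 (all (toggle q x) (size x x∉q))))
    go : ∀ b → d ⊙ χ q ≡ b → SomeNonzero B (suc k) × ¬ AllNonzero B (suc k)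
    go 0ℙ eq = some u u∉q (cong₂ _+_ Buu≡1 eq) , not-all w w∉q (cong₂ _+_ Bww≡0 eq)
    go 1ℙ eq = some w w∉q (cong₂ _+_ Bww≡0 eq) , not-all u u∉q (cong₂ _+_ Buu≡1 eq)

-- Reading a sequence off a matrix.

-- t lists the symbols of B for the orders k + 1, k + 2, …
EprFrom : ∀ {n} → Matrix n → ℕ → List Symbol → Set
EprFrom B k []      = Unit
EprFrom B k (c ∷ t) = HasSymbol B (suc k) c × EprFrom B (suc k) t

EprFrom-lookup : ∀ {n} (B : Matrix n) k t → EprFrom B k t → ∀ i → HasSymbol B (suc (k ℕ.+ toℕ i)) (lookup t i)
EprFrom-lookup B k (c ∷ t) (h , _)  zero    = subst (λ l → HasSymbol B (suc l) c) (sym (ℕ.+-identityʳ k)) h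
EprFrom-lookup B k (c ∷ t) (_ , hs) (suc i) = subst (λ l → HasSymbol B (suc l) (lookup t i)) (sym (ℕ.+-suc k (toℕ i)))
  (EprFrom-lookup B (suc k) t hs i)

EprFrom-tabulate : ∀ {n} (B : Matrix n) k t → (∀ i → HasSymbol B (suc (k ℕ.+ toℕ i)) (lookup t i)) → EprFrom B k t
EprFrom-tabulate B k []      h = tt
EprFrom-tabulate B k (c ∷ t) h = subst (λ l → HasSymbol B (suc l) c) (ℕ.+-identityʳ k) (h zero) ,
  EprFrom-tabulate B (suc k) t λ i → subst (λ l → HasSymbol B (suc l) (lookup t i)) (ℕ.+-suc k (toℕ i)) (h (suc i))

-- The bound k ≤ n provides a subset of order k, which separates A from N.
symbol-unique : ∀ {n} (B : Matrix n) {k} → k ≤ n → ∀ c d → HasSymbol B k c → HasSymbol B k d → c ≡ d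
symbol-unique B k≤n A A _ _ = refl
symbol-unique B k≤n A S all (_ , ¬all) = contradiction all ¬all
symbol-unique B k≤n A N all all0 with size-k k≤n
... | q , size = contradiction (all0 q size) (all q size)
symbol-unique B k≤n S A (_ , ¬all) all = contradiction all ¬all
symbol-unique B k≤n S S _ _ = refl
symbol-unique B k≤n S N ((q , size , minor≢0) , _) all0 = contradiction (all0 q size) minor≢0
symbol-unique B k≤n N A all0 all with size-k k≤n
... | q , size = contradiction (all0 q size) (all q size)
symbol-unique B k≤n N S all0 ((q , size , minor≢0) , _) = contradiction (all0 q size) minor≢0
symbol-unique B k≤n N N _ _ = refl

-- There is only one principal minor of full order.
last≢S : ∀ {n} (B : Matrix n) → ¬ HasSymbol B n S
last≢S {n} B ((p , size , minor≢0) , ¬all) = ¬all λ q size′ → subst (λ r → principalMinor B r ≢ 0ℙ)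
    (p≡q q size′) minor≢0
  where
  p≡q : ∀ q → ∣ q ∣ ≡ n → p ≡ q
  p≡q q size′ = trans (∣p∣≡n⇒p≡⊤ size) (sym (∣p∣≡n⇒p≡⊤ size′))

-- Necessity of the forms.

module _ {n} (B : Matrix n) (sym-B : Symmetric B)
  {u w : Fin n} (Buu≡1 : B u u ≡ 1ℙ) (Bww≡0 : B w w ≡ 0ℙ) where

  all-N : ∀ k t → AllZero B (suc k) → EprFrom B (suc k) t → suc k ℕ.+ length t ≡ n → ∃ λ j → t ≡ j ×[ [ N ] ]
  all-N k []      all0 _        _    = 0 , refl
  all-N k (c ∷ t) all0 (h , hs) size = extend-N (symbol-unique B 2+k≤n c N h all0′) (all-N (suc k) t all0′ hs size′)
    where
    size′ : suc (suc k) ℕ.+ length t ≡ n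
    size′ = trans (sym (ℕ.+-suc (suc k) (length t))) size
    2+k≤n : suc (suc k) ≤ n
    2+k≤n = subst (suc (suc k) ≤_) size′ (ℕ.m≤m+n (suc (suc k)) (length t))
    all0′ : AllZero B (suc (suc k))
    all0′ = AllZero-suc B sym-B Buu≡1 all0
    extend-N : c ≡ N → (∃ λ j → t ≡ j ×[ [ N ] ]) → ∃ λ j → c ∷ t ≡ j ×[ [ N ] ]
    extend-N refl (j , refl) = suc j , refl

  -- What may follow the initial S: the first four forms without that S, or a tight matrix. The
  -- fourth alternative with i = 0 is the alternating sequence SAN; the bound 4 ≤ n later excludes
  -- SA and SAA from the tight case.
  Tail : List Symbol → Set
  Tail t = (∃ λ i → ∃ λ j → t ≡ i ×[ [ S ] ] ++ N ∷ j ×[ [ N ] ])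
    ⊎ (∃ λ i → t ≡ i ×[ [ S ] ] ++ [ A ])
    ⊎ (∃ λ i → t ≡ i ×[ [ S ] ] ++ A ∷ [ A ])
    ⊎ (∃ λ i → t ≡ i ×[ [ S ] ] ++ A ∷ [ N ])
    ⊎ (4 ≤ n × TightMatrix B)

  Tail-S : ∀ t → Tail t → Tail (S ∷ t)
  Tail-S t (inj₁ (i , j , refl))                     = inj₁ (suc i , j , refl)
  Tail-S t (inj₂ (inj₁ (i , refl)))                  = inj₂ (inj₁ (suc i , refl))
  Tail-S t (inj₂ (inj₂ (inj₁ (i , refl))))           = inj₂ (inj₂ (inj₁ (suc i , refl)))
  Tail-S t (inj₂ (inj₂ (inj₂ (inj₁ (i , refl)))))    = inj₂ (inj₂ (inj₂ (inj₁ (suc i , refl))))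
  Tail-S t (inj₂ (inj₂ (inj₂ (inj₂ tight))))         = inj₂ (inj₂ (inj₂ (inj₂ tight)))

  tail-after-S : ∀ k t → HasSymbol B (suc k) S → EprFrom B (suc k) t → suc k ℕ.+ length t ≡ n → Tail t
  tail-after-S k [] h _ size = contradiction (subst (λ l → HasSymbol B l S)
      (trans (sym (ℕ.+-identityʳ (suc k))) size) h) (last≢S B)
  tail-after-S k (N ∷ t) _ (h , hs) size with all-N (suc k) t h hs (trans (sym (ℕ.+-suc (suc k) (length t))) size)
  ... | j , refl = inj₁ (0 , j , refl)
  tail-after-S k (S ∷ t) _ (h , hs) size = Tail-S t
      (tail-after-S (suc k) t h hs (trans (sym (ℕ.+-suc (suc k) (length t))) size))
  tail-after-S k (A ∷ [])         _ _ _ = inj₂ (inj₁ (0 , refl))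
  tail-after-S k (A ∷ A ∷ [])     _ _ _ = inj₂ (inj₂ (inj₁ (0 , refl)))
  tail-after-S k (A ∷ N ∷ [])     _ _ _ = inj₂ (inj₂ (inj₂ (inj₁ (0 , refl))))
  tail-after-S k (A ∷ S ∷ [])     _ (_ , h , _) size = contradiction
    (subst (λ l → HasSymbol B l S) (trans (ℕ.+-comm 2 (suc k)) size) h) (last≢S B)
  -- This A has order k + 2 and at least two orders follow, so k + 4 ≤ n.
  tail-after-S k (A ∷ _ ∷ _ ∷ t) _ (h , _) size = inj₂ (inj₂ (inj₂ (inj₂ (tight (suc-suc size) h))))
    where
    suc-suc : suc k ℕ.+ (3 ℕ.+ length t) ≡ n → 4 ℕ.+ (k ℕ.+ length t) ≡ n
    suc-suc = trans (cong suc (sym (trans (ℕ.+-suc k _) (cong suc (trans (ℕ.+-suc k _) (cong suc (ℕ.+-suc k _)))))))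
    tight : 4 ℕ.+ (k ℕ.+ length t) ≡ n → AllNonzero B (2 ℕ.+ k) → 4 ≤ n × TightMatrix B
    tight refl all = ℕ.m≤m+n 4 _ , AllNonzero⇒tight B sym-B (ℕ.m≤m+n k (length t)) all Bww≡0

  Alternating : List Symbol → Set
  Alternating t = (∃ λ i → t ≡ i ×[ S ∷ [ A ] ]) ⊎ (∃ λ i → t ≡ i ×[ S ∷ [ A ] ] ++ [ A ]) ⊎
      (∃ λ i → t ≡ i ×[ S ∷ [ A ] ] ++ [ N ])

  -- Symbols are read two at a time from an even k: an odd order below n has S, an even order has A.
  -- A last odd order may have A or N.
  alternating : TightMatrix B → ∀ k t → parity k ≡ 0ℙ → EprFrom B k t → k ℕ.+ length t ≡ n → Alternating t
  alternating tight k []      _ _ _ = inj₁ (0 , refl)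
  alternating tight k (A ∷ []) _ _ _ = inj₂ (inj₁ (0 , refl))
  alternating tight k (N ∷ []) _ _ _ = inj₂ (inj₂ (0 , refl))
  alternating tight k (S ∷ []) _ (h , _) size = contradiction
    (subst (λ l → HasSymbol B l S) (trans (ℕ.+-comm 1 k) size) h) (last≢S B)
  alternating tight k (c ∷ d ∷ t) even (h , h′ , hs) size = extend-SA
    (symbol-unique B (ℕ.<⇒≤ 2+k≤n) c S h (tight-odd B tight Buu≡1 Bww≡0 odd 2+k≤n))
    (symbol-unique B 2+k≤n d A h′ (tight-even B tight even))
    (alternating tight (2 ℕ.+ k) t even hs size′)
    where
    size′ : 2 ℕ.+ k ℕ.+ length t ≡ n
    size′ = trans (sym (trans (ℕ.+-suc k _) (cong suc (ℕ.+-suc k _)))) size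
    2+k≤n : 2 ℕ.+ k ≤ n
    2+k≤n = subst (2 ℕ.+ k ≤_) size′ (ℕ.m≤m+n (2 ℕ.+ k) (length t))
    odd : parity (suc k) ≡ 1ℙ
    odd = suc-odd k even
    extend-SA : c ≡ S → d ≡ A → Alternating t → Alternating (c ∷ d ∷ t)
    extend-SA refl refl (inj₁ (i , refl))        = inj₁ (suc i , refl)
    extend-SA refl refl (inj₂ (inj₁ (i , refl))) = inj₂ (inj₁ (suc i , refl))
    extend-SA refl refl (inj₂ (inj₂ (i , refl))) = inj₂ (inj₂ (suc i , refl))

-- Tools for sufficiency.

realize : ∀ {n} (B : Matrix n) → Symmetric B → ∀ s → length s ≡ n → EprFrom B 0 s → Attainable s
realize B sym-B s refl h = B , sym-B , EprFrom-lookup B 0 s h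

EprFrom-run : ∀ {n} (B : Matrix n) c k i t → (∀ l → k < l → l ≤ k ℕ.+ i → HasSymbol B l c) →
  EprFrom B (k ℕ.+ i) t → EprFrom B k (i ×[ [ c ] ] ++ t)
EprFrom-run B c k zero    t h hs = subst (λ l → EprFrom B l t) (ℕ.+-identityʳ k) hs
EprFrom-run B c k (suc i) t h hs = h (suc k) ℕ.≤-refl (ℕ.m<m+n k ℕ.z<s) ,
  EprFrom-run B c (suc k) i t (λ l k<l l≤ → h l (ℕ.<⇒≤ k<l) (subst (l ≤_) (sym (ℕ.+-suc k i)) l≤))
    (subst (λ l → EprFrom B l t) (ℕ.+-suc k i) hs)

length-run : ∀ c i t → length (i ×[ [ c ] ] ++ t) ≡ i ℕ.+ length t
length-run c zero    t = refl
length-run c (suc i) t = cong suc (length-run c i t)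

exceed : ∀ {n} (p q : Subset n) → ∣ q ∣ < ∣ p ∣ → ∃ λ r → χ p r ≡ 1ℙ × χ q r ≡ 0ℙ
exceed (true  ∷ p) (false ∷ q) _       = zero , refl , refl
exceed (true  ∷ p) (true  ∷ q) (s≤s <) with exceed p q <
... | r , r∈p , r∉q = suc r , r∈p , r∉q
exceed (false ∷ p) (false ∷ q) <       with exceed p q <
... | r , r∈p , r∉q = suc r , r∈p , r∉q
exceed (false ∷ p) (true  ∷ q) <       with exceed p q (ℕ.<⇒≤ <)
... | r , r∈p , r∉q = suc r , r∈p , r∉q

identity-feasible : ∀ {n} (B : Matrix n) {X : Fin n → Parity} →
  (∀ r s → X r ≡ 1ℙ → X s ≡ 1ℙ → B r s ≡ δ r s) → Feasible B X
identity-feasible B {X} id v eq r with X r in r∈? | eq r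
... | 0ℙ | vr≡0 = vr≡0
... | 1ℙ | Bvr≡0 = trans (sym (trans (sum-cong-≗ λ s → entry s (X s) refl (eq s)) (sum-δ r v))) Bvr≡0
  where
  entry : ∀ s x → X s ≡ x → mix (X s) (v s) ((B · v) s) ≡ 0ℙ → B r s * v s ≡ δ r s * v s
  entry s 1ℙ s∈ _  = cong (_* v s) (id r s r∈? s∈)
  entry s 0ℙ s∉ eq = trans (cong (B r s *_) vs≡0)
      (trans (Parity.*-zeroʳ (B r s)) (sym (trans (cong (δ r s *_) vs≡0) (Parity.*-zeroʳ (δ r s)))))
    where
    vs≡0 : v s ≡ 0ℙ
    vs≡0 = trans (sym (cong (λ x → mix x (v s) ((B · v) s)) s∉)) eq

-- Subsets of Z are feasible, sets {x} ∪ Y with Y ⊆ W are not.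
order-S : ∀ {n} (B : Matrix n) (Z W : Subset n) (x : Fin n) →
  (∀ r s → χ Z r ≡ 1ℙ → χ Z s ≡ 1ℙ → B r s ≡ δ r s) →
  χ W x ≡ 0ℙ → B x x ≡ 0ℙ → (∀ r → χ W r ≡ 1ℙ → B r x ≡ 0ℙ) →
  ∀ {k} → 0 < k → k ≤ ∣ Z ∣ → k ≤ suc ∣ W ∣ → HasSymbol B k S
order-S B Z W x id x∉W Bxx≡0 column {suc k} _ k≤Z (s≤s k≤W) = some (subset-of-size Z k≤Z) ,
    not-all (subset-of-size W k≤W)
  where
  some : (∃ λ q → ∣ q ∣ ≡ suc k × (∀ r → χ Z r ≡ 0ℙ → χ q r ≡ 0ℙ)) → SomeNonzero B (suc k)
  some (q , size , q⊆Z) = q , size , λ minor≡0 → 0≢1 minor≡0 (feasible⇒minor≡1 B q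
    (identity-feasible B λ r s r∈q s∈q → id r s (⊆ r r∈q) (⊆ s s∈q)))
    where
    ⊆ : ∀ r → χ q r ≡ 1ℙ → χ Z r ≡ 1ℙ
    ⊆ r r∈q = ≢0⇒≡1 λ r∉Z → 0≢1 (q⊆Z r r∉Z) r∈q
  not-all : (∃ λ q → ∣ q ∣ ≡ k × (∀ r → χ W r ≡ 0ℙ → χ q r ≡ 0ℙ)) → ¬ AllNonzero B (suc k)
  not-all (q , size , q⊆W) all = infeasible B (δ x) (δ-refl x) off on
    (minor≡1⇒feasible B (toggle q x) (≢0⇒≡1 (all (toggle q x) (trans (∣toggle∣-∉ q x (q⊆W x x∉W)) (cong suc size)))))
    where
    off : ∀ r → χ (toggle q x) r ≡ 0ℙ → δ x r ≡ 0ℙ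
    off r r∉ = δ-≢ {i = x} {r} λ eq → 0≢1 r∉ (trans (χ-toggle q x r)
        (cong₂ _+_ (trans (cong (δ x) (sym eq)) (δ-refl x)) (trans (cong (χ q) (sym eq)) (q⊆W x x∉W))))
    on : ∀ r → χ (toggle q x) r ≡ 1ℙ → (B · δ x) r ≡ 0ℙ
    on r r∈ with x ≟ r
    ... | yes refl = trans (⊙-δ (B r) r) Bxx≡0
    ... | no x≢r   = trans (⊙-δ (B r) x) (column r (≢0⇒≡1 λ r∉W → 0≢1 (q⊆W r r∉W)
            (trans (sym (trans (χ-toggle q x r) (cong (_+ χ q r) (δ-≢ x≢r)))) r∈)))

-- Matrices attaining the forms

diagonal-matrix : ∀ {n} → (Fin n → Parity) → Matrix n
diagonal-matrix d r s = d r * δ r s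

module _ {n} (Z : Subset n) where
  private
    B = diagonal-matrix (χ Z)

  diagonal-symmetric : Symmetric B
  diagonal-symmetric r s with r ≟ s
  ... | yes refl = refl
  ... | no r≢s   = trans (cong (χ Z r *_) (δ-≢ r≢s)) (trans (Parity.*-zeroʳ (χ Z r))
    (sym (trans (cong (χ Z s *_) (δ-≢ (r≢s ∘ sym))) (Parity.*-zeroʳ (χ Z s)))))

  -- Some x lies outside Z and has a zero column, so every set containing x is infeasible.
  diagonal-S : ∣ Z ∣ < n → ∀ l → 0 < l → l ≤ ∣ Z ∣ → HasSymbol B l S
  diagonal-S Z<n l 0<l l≤Z with exceed ⊤ Z (subst (∣ Z ∣ <_) (sym (∣⊤∣≡n n)) Z<n)
  ... | x , _ , x∉Z = order-S B Z (toggle ⊤ x) x (λ r s r∈Z _ → cong (_* δ r s) r∈Z)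
      (trans (χ-toggle ⊤ x x) (cong₂ _+_ (δ-refl x) (χ-⊤ x))) (cong (_* δ x x) x∉Z)
      (λ r r∈ → trans (cong (χ Z r *_) (δ-≢ {i = r} {x} λ eq → 0≢1
        (trans (χ-toggle ⊤ x r) (cong₂ _+_ (trans (cong (δ x) eq) (δ-refl x)) (χ-⊤ r))) r∈)) (Parity.*-zeroʳ (χ Z r)))
      0<l l≤Z (ℕ.≤-trans l≤Z (ℕ.≤-trans (∣p∣≤n Z) (ℕ.≤-reflexive (sym (trans (∣toggle∣-∈ ⊤ x (χ-⊤ x)) (∣⊤∣≡n n))))))

  -- A set larger than Z contains an index with a zero column.
  diagonal-N : ∀ l → ∣ Z ∣ < l → HasSymbol B l N
  diagonal-N l Z<l p size with exceed p Z (subst (∣ Z ∣ <_) (sym size) Z<l)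
  ... | r , r∈p , r∉Z = ≢1⇒≡0 λ minor≡1 → infeasible B (δ r) (δ-refl r)
      (λ s s∉p → δ-≢ {i = r} {s} λ eq → 0≢1 s∉p (trans (cong (χ p) (sym eq)) r∈p))
      (λ s _ → trans (⊙-δ (B s) r) (column s)) (minor≡1⇒feasible B p minor≡1)
    where
    column : ∀ s → χ Z s * δ s r ≡ 0ℙ
    column s with s ≟ r
    ... | yes refl = cong (_* δ s s) r∉Z
    ... | no s≢r   = trans (cong (χ Z s *_) (δ-≢ s≢r)) (Parity.*-zeroʳ (χ Z s))

attain-SN : ∀ i j → Attainable (suc i ×[ [ S ] ] ++ N ∷ j ×[ [ N ] ])
-- The rank i + 1 of the diagonal matrix is the number of leading S.
attain-SN i j with size-k {suc i ℕ.+ suc j} {suc i} (ℕ.m≤m+n (suc i) (suc j))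
... | Z , size = realize (diagonal-matrix (χ Z)) (diagonal-symmetric Z) (suc i ×[ [ S ] ] ++ suc j ×[ [ N ] ])
  (trans (length-run S (suc i) _) (cong (suc i ℕ.+_) (trans (cong length (sym (++-identityʳ (suc j ×[ [ N ] ]))))
    (trans (length-run N (suc j) []) (ℕ.+-identityʳ (suc j))))))
  (EprFrom-run _ S 0 (suc i) (suc j ×[ [ N ] ])
    (λ l 0<l l≤ → diagonal-S Z (subst (_< suc i ℕ.+ suc j) (sym size) (ℕ.m<m+n (suc i) ℕ.z<s)) l 0<l
        (subst (l ≤_) (sym size) l≤))
    (subst (EprFrom _ (suc i)) (++-identityʳ (suc j ×[ [ N ] ]))
      (EprFrom-run _ N (suc i) (suc j) [] (λ l <l _ → diagonal-N Z l (subst (_< l) (sym size) <l)) tt)))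

zeros-⊙ : ∀ {n} (v : Fin n → Parity) → const 0ℙ ⊙ v ≡ 0ℙ
zeros-⊙ v = sum-zero {f = λ j → 0ℙ * v j} λ _ → refl

module _ (i : ℕ) where
  private
    -- The nonsingular block with rows 01, 11 beside an identity. `Z` omits index 0, which has zero
    -- diagonal and is orthogonal to the identity part `W`.
    B : Matrix (2 ℕ.+ i)
    B zero          = 0ℙ ◂ (1ℙ ◂ const 0ℙ)
    B (suc zero)    = 1ℙ ◂ (1ℙ ◂ const 0ℙ)
    B (suc (suc r)) = 0ℙ ◂ (0ℙ ◂ δ r)

    sym-B : Symmetric B
    sym-B zero          zero          = refl
    sym-B zero          (suc zero)    = refl
    sym-B zero          (suc (suc _)) = refl
    sym-B (suc zero)    zero          = refl
    sym-B (suc zero)    (suc zero)    = refl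
    sym-B (suc zero)    (suc (suc _)) = refl
    sym-B (suc (suc _)) zero          = refl
    sym-B (suc (suc _)) (suc zero)    = refl
    sym-B (suc (suc r)) (suc (suc s)) = δ-sym r s

    Z W : Subset (2 ℕ.+ i)
    Z = false ∷ true  ∷ ⊤
    W = false ∷ false ∷ ⊤

    Z-identity : ∀ r s → χ Z r ≡ 1ℙ → χ Z s ≡ 1ℙ → B r s ≡ δ r s
    Z-identity (suc zero)    (suc zero)    _ _ = refl
    Z-identity (suc zero)    (suc (suc s)) _ _ = refl
    Z-identity (suc (suc r)) (suc zero)    _ _ = refl
    Z-identity (suc (suc r)) (suc (suc s)) _ _ = refl

    injective : Injective B
    injective v Bv≡0 = λ where
        zero          → v₀
        (suc zero)    → v₁
        (suc (suc r)) → trans (sym (sum-δ r w)) (Bv≡0 (suc (suc r)))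
      where
      w : Fin i → Parity
      w r = v (suc (suc r))
      v₁ : v (suc zero) ≡ 0ℙ
      v₁ = trans (sym (trans (cong (v (suc zero) +_) (zeros-⊙ w)) (Parity.+-identityʳ _))) (Bv≡0 zero)
      v₀ : v zero ≡ 0ℙ
      v₀ = trans (sym (trans (cong₂ (λ a b → v zero + (a + b)) v₁ (zeros-⊙ w)) (Parity.+-identityʳ _)))
          (Bv≡0 (suc zero))

  attain-SA : Attainable (suc i ×[ [ S ] ] ++ [ A ])
  attain-SA = realize B sym-B _ (trans (length-run S (suc i) [ A ]) (ℕ.+-comm (suc i) 1))
    (EprFrom-run B S 0 (suc i) [ A ]
      (λ l 0<l l≤ → order-S B Z W zero Z-identity refl refl (λ { (suc (suc r)) _ → refl }) 0<l
        (subst (l ≤_) (sym (cong suc (∣⊤∣≡n i))) l≤) (subst (l ≤_) (sym (cong suc (∣⊤∣≡n i))) l≤))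
      ((λ p size minor≡0 → 0≢1 minor≡0 (feasible⇒minor≡1 B p λ v eq → injective v λ r →
        trans (sym (cong (λ x → mix x (v r) ((B · v) r)) (χ-⊤-size p size r))) (eq r))) , tt))

module _ (i : ℕ) where
  private
    -- The block with rows 011, 111, 110 beside an identity; every principal minor of this block of
    -- order 2 or 3 is 1.
    B : Matrix (3 ℕ.+ i)
    B zero                = 0ℙ ◂ (1ℙ ◂ (1ℙ ◂ const 0ℙ))
    B (suc zero)          = 1ℙ ◂ (1ℙ ◂ (1ℙ ◂ const 0ℙ))
    B (suc (suc zero))    = 1ℙ ◂ (1ℙ ◂ (0ℙ ◂ const 0ℙ))
    B (suc (suc (suc r))) = 0ℙ ◂ (0ℙ ◂ (0ℙ ◂ δ r))

    sym-B : Symmetric B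
    sym-B zero                zero                = refl
    sym-B zero                (suc zero)          = refl
    sym-B zero                (suc (suc zero))    = refl
    sym-B zero                (suc (suc (suc _))) = refl
    sym-B (suc zero)          zero                = refl
    sym-B (suc zero)          (suc zero)          = refl
    sym-B (suc zero)          (suc (suc zero))    = refl
    sym-B (suc zero)          (suc (suc (suc _))) = refl
    sym-B (suc (suc zero))    zero                = refl
    sym-B (suc (suc zero))    (suc zero)          = refl
    sym-B (suc (suc zero))    (suc (suc zero))    = refl
    sym-B (suc (suc zero))    (suc (suc (suc _))) = refl
    sym-B (suc (suc (suc _))) zero                = refl
    sym-B (suc (suc (suc _))) (suc zero)          = refl
    sym-B (suc (suc (suc _))) (suc (suc zero))    = refl
    sym-B (suc (suc (suc r))) (suc (suc (suc s))) = δ-sym r s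

    Z W : Subset (3 ℕ.+ i)
    Z = false ∷ true  ∷ false ∷ ⊤
    W = false ∷ false ∷ false ∷ ⊤

    Z-identity : ∀ r s → χ Z r ≡ 1ℙ → χ Z s ≡ 1ℙ → B r s ≡ δ r s
    Z-identity (suc zero)          (suc zero)          _ _ = refl
    Z-identity (suc zero)          (suc (suc (suc s))) _ _ = refl
    Z-identity (suc (suc (suc r))) (suc zero)          _ _ = refl
    Z-identity (suc (suc (suc r))) (suc (suc (suc s))) _ _ = refl

    majority : Parity → Parity → Parity → Parity
    majority x y z = x * y + x * z + y * z

    -- `majority` is 1 exactly when at least two of the three block indices lie in X, and the
    -- identity part splits off.
    majority-feasible : ∀ X → majority (X zero) (X (suc zero)) (X (suc (suc zero))) ≡ 1ℙ → Feasible B X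
    majority-feasible X maj v eq = λ where
        zero                → proj₁ v≡0
        (suc zero)          → proj₁ (proj₂ v≡0)
        (suc (suc zero))    → proj₂ (proj₂ v≡0)
        (suc (suc (suc r))) → trans (sym (mix-idem (X (suc (suc (suc r)))) (w r)))
          (trans (cong (mix (X (suc (suc (suc r)))) (w r)) (sym (sum-δ r w))) (eq (suc (suc (suc r)))))
      where
      x₀ = X zero
      x₁ = X (suc zero)
      x₂ = X (suc (suc zero))
      v₀ = v zero
      v₁ = v (suc zero)
      v₂ = v (suc (suc zero))
      w : Fin i → Parity
      w r = v (suc (suc (suc r)))
      mix-idem : ∀ x a → mix x a a ≡ a
      mix-idem 0ℙ a = refl
      mix-idem 1ℙ a = refl
      solve : ∀ x₀ x₁ x₂ v₀ v₁ v₂ → majority x₀ x₁ x₂ ≡ 1ℙ →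
        mix x₀ v₀ (v₁ + (v₂ + 0ℙ)) ≡ 0ℙ → mix x₁ v₁ (v₀ + (v₁ + (v₂ + 0ℙ))) ≡ 0ℙ → mix x₂ v₂ (v₀ + (v₁ + 0ℙ)) ≡ 0ℙ →
        (v₀ ≡ 0ℙ) × ((v₁ ≡ 0ℙ) × (v₂ ≡ 0ℙ))
      solve = from-yes (∀ℙ? λ x₀ → ∀ℙ? λ x₁ → ∀ℙ? λ x₂ → ∀ℙ? λ v₀ → ∀ℙ? λ v₁ → ∀ℙ? λ v₂ →
        (majority x₀ x₁ x₂ Parity.≟ 1ℙ) →-dec ((mix x₀ v₀ (v₁ + (v₂ + 0ℙ)) Parity.≟ 0ℙ) →-dec
        ((mix x₁ v₁ (v₀ + (v₁ + (v₂ + 0ℙ))) Parity.≟ 0ℙ) →-dec ((mix x₂ v₂ (v₀ + (v₁ + 0ℙ)) Parity.≟ 0ℙ) →-dec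
        ((v₀ Parity.≟ 0ℙ) ×-dec ((v₁ Parity.≟ 0ℙ) ×-dec (v₂ Parity.≟ 0ℙ)))))))
      v≡0 : (v₀ ≡ 0ℙ) × ((v₁ ≡ 0ℙ) × (v₂ ≡ 0ℙ))
      v≡0 = solve x₀ x₁ x₂ v₀ v₁ v₂ maj
        (trans (cong (λ a → mix x₀ v₀ (v₁ + (v₂ + a))) (sym (zeros-⊙ w))) (eq zero))
        (trans (cong (λ a → mix x₁ v₁ (v₀ + (v₁ + (v₂ + a)))) (sym (zeros-⊙ w))) (eq (suc zero)))
        (trans (cong (λ a → mix x₂ v₂ (v₀ + (v₁ + a))) (sym (zeros-⊙ w))) (eq (suc (suc zero))))

    -- Omitting two block indices leaves at most i + 1 elements.
    large-majority : ∀ (p : Subset (3 ℕ.+ i)) → 2 ℕ.+ i ≤ ∣ p ∣ →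
      majority (χ p zero) (χ p (suc zero)) (χ p (suc (suc zero))) ≡ 1ℙ
    large-majority (true  ∷ true  ∷ true  ∷ q) _ = refl
    large-majority (true  ∷ true  ∷ false ∷ q) _ = refl
    large-majority (true  ∷ false ∷ true  ∷ q) _ = refl
    large-majority (false ∷ true  ∷ true  ∷ q) _ = refl
    large-majority (true  ∷ false ∷ false ∷ q) (s≤s big) = contradiction (∣p∣≤n q) (ℕ.<⇒≱ big)
    large-majority (false ∷ true  ∷ false ∷ q) (s≤s big) = contradiction (∣p∣≤n q) (ℕ.<⇒≱ big)
    large-majority (false ∷ false ∷ true  ∷ q) (s≤s big) = contradiction (∣p∣≤n q) (ℕ.<⇒≱ big)
    large-majority (false ∷ false ∷ false ∷ q) big       = contradiction (∣p∣≤n q) (ℕ.<⇒≱ (ℕ.<⇒≤ big))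

    large : ∀ l → 2 ℕ.+ i ≤ l → AllNonzero B l
    large l big p size minor≡0 = 0≢1 minor≡0
      (feasible⇒minor≡1 B p (majority-feasible (χ p) (large-majority p (subst (2 ℕ.+ i ≤_) (sym size) big))))

  attain-SAA : Attainable (suc i ×[ [ S ] ] ++ A ∷ [ A ])
  attain-SAA = realize B sym-B _ (trans (length-run S (suc i) (A ∷ [ A ])) (ℕ.+-comm (suc i) 2))
    (EprFrom-run B S 0 (suc i) (A ∷ [ A ])
      (λ l 0<l l≤ → order-S B Z W zero Z-identity refl refl (λ { (suc (suc (suc r))) _ → refl }) 0<l
        (subst (l ≤_) (sym (cong suc (∣⊤∣≡n i))) l≤) (subst (l ≤_) (sym (cong suc (∣⊤∣≡n i))) l≤))
      (large (2 ℕ.+ i) ℕ.≤-refl , large (3 ℕ.+ i) (ℕ.n≤1+n (2 ℕ.+ i)) , tt))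

module _ {n} (B : Matrix n) (sym-B : Symmetric B) (B·1≡0 : ∀ r → (B · const 1ℙ) r ≡ 0ℙ) where

  constant-kernel-N : Fin n → HasSymbol B n N
  constant-kernel-N r p size = ≢1⇒≡0 λ minor≡1 → infeasible B (const 1ℙ) {r} refl
    (λ s s∉p → contradiction (χ-⊤-size p size s) (0≢1 s∉p)) (λ s _ → B·1≡0 s) (minor≡1⇒feasible B p minor≡1)

  -- Here p omits a single r. If B v vanishes off r, it vanishes at r too, since the entries of B v
  -- sum to (B 1)·v = 0. So v is constant, with value v r = 0.
  constant-kernel-A : (∀ v → (∀ r → (B · v) r ≡ 0ℙ) → ∀ r s → v r ≡ v s) → ∀ {k} → suc k ≡ n → HasSymbol B k A
  constant-kernel-A constant {k} refl p size minor≡0 with exceed ⊤ p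
      (subst₂ _<_ (sym size) (sym (∣⊤∣≡n (suc k))) ℕ.≤-refl)
  ... | r , _ , r∉p = 0≢1 minor≡0 (feasible⇒minor≡1 B p feas)
    where
    others : ∀ s → r ≢ s → χ p s ≡ 1ℙ
    others s r≢s = trans (sym (trans (χ-toggle p r s) (cong (_+ χ p s) (δ-≢ r≢s))))
      (χ-⊤-size (toggle p r) (trans (∣toggle∣-∉ p r r∉p) (cong suc size)) s)
    feas : Feasible B (χ p)
    feas v eq s = trans (constant v Bv≡0 s r) vr≡0
      where
      vr≡0 : v r ≡ 0ℙ
      vr≡0 = trans (sym (cong (λ x → mix x (v r) ((B · v) r)) r∉p)) (eq r)
      Bv≡ : ∀ s → (B · v) s ≡ δ r s * (B · v) s
      Bv≡ s with r ≟ s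
      ... | yes refl = cong (_* (B · v) s) (sym (δ-refl s))
      ... | no r≢s   = trans (trans (sym (cong (λ x → mix x (v s) ((B · v) s)) (others s r≢s))) (eq s))
              (sym (cong (_* (B · v) s) (δ-≢ r≢s)))
      total : (B · v) r ≡ 0ℙ
      total = begin
        (B · v) r                     ≡⟨ sum-δ r (B · v) ⟨
        δ r ⊙ (B · v)                 ≡⟨ sum-cong-≗ Bv≡ ⟨
        const 1ℙ ⊙ (B · v)            ≡⟨ self-adjoint B sym-B (const 1ℙ) v ⟩
        (B · const 1ℙ) ⊙ v            ≡⟨ ⊙-congʳ v B·1≡0 ⟩
        const 0ℙ ⊙ v                  ≡⟨ zeros-⊙ v ⟩
        0ℙ                            ∎
        where open ≡-Reasoning
      Bv≡0 : ∀ s → (B · v) s ≡ 0ℙ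
      Bv≡0 s with r ≟ s
      ... | yes refl = total
      ... | no r≢s   = trans (Bv≡ s) (cong (_* (B · v) s) (δ-≢ r≢s))

module _ (i : ℕ) where
  -- The Laplacian modulo 2 of the tree made of a path 0 - 1 - 2 and of i + 1 leaves attached to 2.
  private
    -- The degree of vertex 2: the path neighbour 1 and the i + 1 leaves.
    hub : Parity
    hub = 1ℙ + sum {suc i} (const 1ℙ)

    B : Matrix (4 ℕ.+ i)
    B zero                = 1ℙ ◂ (1ℙ ◂ (0ℙ ◂ const 0ℙ))
    B (suc zero)          = 1ℙ ◂ (0ℙ ◂ (1ℙ ◂ const 0ℙ))
    B (suc (suc zero))    = 0ℙ ◂ (1ℙ ◂ (hub ◂ const 1ℙ))
    B (suc (suc (suc r))) = 0ℙ ◂ (0ℙ ◂ (1ℙ ◂ δ r))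

    sym-B : Symmetric B
    sym-B zero                zero                = refl
    sym-B zero                (suc zero)          = refl
    sym-B zero                (suc (suc zero))    = refl
    sym-B zero                (suc (suc (suc _))) = refl
    sym-B (suc zero)          zero                = refl
    sym-B (suc zero)          (suc zero)          = refl
    sym-B (suc zero)          (suc (suc zero))    = refl
    sym-B (suc zero)          (suc (suc (suc _))) = refl
    sym-B (suc (suc zero))    zero                = refl
    sym-B (suc (suc zero))    (suc zero)          = refl
    sym-B (suc (suc zero))    (suc (suc zero))    = refl
    sym-B (suc (suc zero))    (suc (suc (suc _))) = refl
    sym-B (suc (suc (suc _))) zero                = refl
    sym-B (suc (suc (suc _))) (suc zero)          = refl
    sym-B (suc (suc (suc _))) (suc (suc zero))    = refl
    sym-B (suc (suc (suc r))) (suc (suc (suc s))) = δ-sym r s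

    -- Vertex 0 and the leaves are pairwise nonadjacent and of degree 1, so B is the identity on
    -- `Z`. Vertex 1 has even degree and is adjacent to no leaf in `W`.
    Z W : Subset (4 ℕ.+ i)
    Z = true  ∷ false ∷ false ∷ ⊤
    W = false ∷ false ∷ false ∷ ⊤

    Z-identity : ∀ r s → χ Z r ≡ 1ℙ → χ Z s ≡ 1ℙ → B r s ≡ δ r s
    Z-identity zero                zero                _ _ = refl
    Z-identity zero                (suc (suc (suc s))) _ _ = refl
    Z-identity (suc (suc (suc r))) zero                _ _ = refl
    Z-identity (suc (suc (suc r))) (suc (suc (suc s))) _ _ = refl

    leaf-row : ∀ (v : Fin (4 ℕ.+ i) → Parity) r →
      (B · v) (suc (suc (suc r))) ≡ v (suc (suc zero)) + v (suc (suc (suc r)))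
    leaf-row v r = cong (v (suc (suc zero)) +_) (sum-δ r (λ s → v (suc (suc (suc s)))))

    B·1≡0 : ∀ r → (B · const 1ℙ) r ≡ 0ℙ
    B·1≡0 zero                = cong (λ a → 1ℙ + (1ℙ + a)) (zeros-⊙ {suc i} (const 1ℙ))
    B·1≡0 (suc zero)          = cong (λ a → 1ℙ + (1ℙ + a)) (zeros-⊙ {suc i} (const 1ℙ))
    B·1≡0 (suc (suc zero))    = cancel (sum {suc i} (const 1ℙ))
      where
      cancel : ∀ a → 1ℙ + ((1ℙ + a) * 1ℙ + a) ≡ 0ℙ
      cancel 0ℙ = refl
      cancel 1ℙ = refl
    B·1≡0 (suc (suc (suc r))) = leaf-row (const 1ℙ) r

    -- Connectedness of the tree: rows 0 and 1 equate the values at 1 and 2 with that at 0, and each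
    -- leaf row equates its leaf with vertex 2.
    constant : ∀ v → (∀ r → (B · v) r ≡ 0ℙ) → ∀ r s → v r ≡ v s
    constant v Bv≡0 r s = trans (≡v₀ r) (sym (≡v₀ s))
      where
      v₀ = v zero
      v₁ = v (suc zero)
      v₂ = v (suc (suc zero))
      w : Fin (suc i) → Parity
      w r = v (suc (suc (suc r)))
      v₀≡v₁ : v₀ ≡ v₁
      v₀≡v₁ = x+y≡0⇒x≡y v₀ v₁ (trans (cong (v₀ +_) (sym (trans (cong (v₁ +_) (zeros-⊙ w)) (Parity.+-identityʳ v₁))))
          (Bv≡0 zero))
      v₀≡v₂ : v₀ ≡ v₂
      v₀≡v₂ = x+y≡0⇒x≡y v₀ v₂ (trans (cong (v₀ +_) (sym (trans (cong (v₂ +_) (zeros-⊙ w)) (Parity.+-identityʳ v₂))))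
          (Bv≡0 (suc zero)))
      ≡v₀ : ∀ r → v r ≡ v₀
      ≡v₀ zero                = refl
      ≡v₀ (suc zero)          = sym v₀≡v₁
      ≡v₀ (suc (suc zero))    = sym v₀≡v₂
      ≡v₀ (suc (suc (suc r))) = trans (sym (x+y≡0⇒x≡y v₂ (w r)
          (trans (sym (leaf-row v r)) (Bv≡0 (suc (suc (suc r))))))) (sym v₀≡v₂)

  attain-SSAN : Attainable (suc (suc i) ×[ [ S ] ] ++ A ∷ [ N ])
  attain-SSAN = realize B sym-B _ (trans (length-run S (suc (suc i)) (A ∷ [ N ])) (ℕ.+-comm (suc (suc i)) 2))
    (EprFrom-run B S 0 (suc (suc i)) (A ∷ [ N ])
      (λ l 0<l l≤ → order-S B Z W (suc zero) Z-identity refl refl (λ { (suc (suc (suc r))) _ → refl }) 0<l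
        (subst (l ≤_) (sym (cong suc (∣⊤∣≡n (suc i)))) l≤) (subst (l ≤_) (sym (cong suc (∣⊤∣≡n (suc i)))) l≤))
      (constant-kernel-A B sym-B B·1≡0 constant refl , constant-kernel-N B sym-B B·1≡0 zero , tt))

-- Alternating sequences.

tight-matrix : ∀ {n} → (Fin n → Parity) → Matrix n
tight-matrix d r s = 1ℙ + d r * d s + δ r s

module _ {n} (d : Fin n → Parity) where

  tight-matrix-diagonal : diagonal (tight-matrix d) ≗ d
  tight-matrix-diagonal r = trans (cong (1ℙ + d r * d r +_) (δ-refl r)) (idem (d r))
    where
    idem : ∀ a → 1ℙ + a * a + 1ℙ ≡ a
    idem 0ℙ = refl
    idem 1ℙ = refl

  tight-matrix-symmetric : Symmetric (tight-matrix d)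
  tight-matrix-symmetric r s = cong₂ (λ a b → 1ℙ + a + b) (Parity.*-comm (d r) (d s)) (δ-sym r s)

  tight-matrix-tight : TightMatrix (tight-matrix d)
  tight-matrix-tight r s r≢s = trans (cong (1ℙ + d r * d s +_) (δ-≢ r≢s)) (trans (Parity.+-identityʳ (1ℙ + d r * d s))
    (sym (cong₂ (λ a b → 1ℙ + a * b) (tight-matrix-diagonal r) (tight-matrix-diagonal s))))

sum-1 : ∀ n → sum {n} (const 1ℙ) ≡ parity n
sum-1 n = trans (sum-cong-≗ {n} {λ _ → 1ℙ} {χ ⊤} (λ r → sym (χ-⊤ r))) (trans (sum-χ (⊤ {n})) (cong parity (∣⊤∣≡n n)))

module _ (i : ℕ) (t : List Symbol) where
  private
    s = i ×[ S ∷ [ A ] ] ++ t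
    n = length s

  -- The blocks SA need only one entry 1 and one entry 0 in d; the finer choice of d affects the
  -- ending, supplied by `ends`.
  attain-alternating : (d : Fin n → Parity) {u w : Fin n} → d u ≡ 1ℙ → d w ≡ 0ℙ →
    (∀ k → parity k ≡ 0ℙ → k ℕ.+ length t ≡ n → EprFrom (tight-matrix d) k t) → Attainable s
  attain-alternating d {u} {w} du≡1 dw≡0 ends = realize B (tight-matrix-symmetric d) s refl (go i 0 refl refl)
    where
    B = tight-matrix d
    go : ∀ j k → parity k ≡ 0ℙ → k ℕ.+ length (j ×[ S ∷ [ A ] ] ++ t) ≡ n → EprFrom B k (j ×[ S ∷ [ A ] ] ++ t)
    go zero    k even size = ends k even size
    go (suc j) k even size =
        tight-odd B (tight-matrix-tight d) (trans (tight-matrix-diagonal d u) du≡1)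
            (trans (tight-matrix-diagonal d w) dw≡0) odd 2+k≤n
      , tight-even B (tight-matrix-tight d) even
      , go j (2 ℕ.+ k) even size′
      where
      size′ : 2 ℕ.+ k ℕ.+ length (j ×[ S ∷ [ A ] ] ++ t) ≡ n
      size′ = trans (sym (trans (ℕ.+-suc k _) (cong suc (ℕ.+-suc k _)))) size
      2+k≤n : 2 ℕ.+ k ≤ n
      2+k≤n = subst (2 ℕ.+ k ≤_) size′ (ℕ.m≤m+n (2 ℕ.+ k) _)
      odd : parity (suc k) ≡ 1ℙ
      odd = suc-odd k even

odd-order : ∀ k {n} → parity k ≡ 0ℙ → k ℕ.+ 1 ≡ n → parity n ≡ 1ℙ
odd-order k even refl = trans (cong parity (ℕ.+-comm k 1)) (suc-odd k even)

attain-SA∗ : ∀ i → Attainable (suc i ×[ S ∷ [ A ] ])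
attain-SA∗ i = subst Attainable (++-identityʳ (suc i ×[ S ∷ [ A ] ]))
    (attain-alternating (suc i) [] (δ zero) {zero} {suc zero} refl refl (λ _ _ _ → tt))

-- A single nonzero diagonal entry makes their number odd, so the full set is feasible.
attain-SA∗A : ∀ i → Attainable (suc i ×[ S ∷ [ A ] ] ++ [ A ])
attain-SA∗A i = attain-alternating (suc i) [ A ] d {zero} {suc zero} refl refl λ k even size → all k size , tt
  where
  d : Fin (length (suc i ×[ S ∷ [ A ] ] ++ [ A ])) → Parity
  d = δ zero
  all : ∀ k → k ℕ.+ 1 ≡ length (suc i ×[ S ∷ [ A ] ] ++ [ A ]) → AllNonzero (tight-matrix d) (suc k)
  all k size p ∣p∣≡ minor≡0 = 0≢1 minor≡0 (feasible⇒minor≡1 (tight-matrix d) p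
    (tight-feasible (tight-matrix d) (tight-matrix-tight d) (χ p) (trans (cong (λ a → sum (χ p) * (1ℙ + a))
      (trans (⊙-congʳ (χ p) (tight-matrix-diagonal d))
          (trans (sum-δ zero (χ p)) (χ-⊤-size p (trans ∣p∣≡ (trans (ℕ.+-comm 1 k) size)) zero))))
      (Parity.*-zeroʳ (sum (χ p))))))

-- The order n is odd, and all diagonal entries but one are nonzero: their number is even, so the
-- full set is infeasible.
attain-SA∗N : ∀ i → Attainable (suc i ×[ S ∷ [ A ] ] ++ [ N ])
attain-SA∗N i = attain-alternating (suc i) [ N ] d {suc zero} {zero} refl refl λ k even size → all0 k even size , tt
  where
  n = length (suc i ×[ S ∷ [ A ] ] ++ [ N ])
  d : Fin n → Parity
  d r = 1ℙ + δ zero r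
  all0 : ∀ k → parity k ≡ 0ℙ → k ℕ.+ 1 ≡ n → AllZero (tight-matrix d) (suc k)
  all0 k even size p ∣p∣≡ = ≢1⇒≡0 λ minor≡1 → tight-infeasible (tight-matrix d) (tight-matrix-tight d) (χ p)
      (trans (sum-cong-≗ full) n-odd)
      (trans (⊙-congʳ (χ p) (tight-matrix-diagonal d))
          (trans (⊙-congˡ d full) (trans (+-⊙ {n} (const 1ℙ) (δ zero) (const 1ℙ))
        (cong₂ _+_ n-odd (sum-δ {n} zero (const 1ℙ))))))
      (minor≡1⇒feasible (tight-matrix d) p minor≡1)
    where
    full : ∀ r → χ p r ≡ 1ℙ
    full = χ-⊤-size p (trans ∣p∣≡ (trans (ℕ.+-comm 1 k) size))
    n-odd : sum {n} (const 1ℙ) ≡ 1ℙ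
    n-odd = trans (sum-1 n) (odd-order k even size)

theorem3p11 : (s t : List Symbol) → s ≡ S ∷ t →
    EPR.Attainable ℤ₂ s
    ⇔ ( (∃[ i ] ∃[ j ] s ≡ [ S ] ++ i ×[ [ S ] ] ++ [ N ] ++ j ×[ [ N ] ])
    ⊎ (∃[ i ] s ≡ [ S ] ++ i ×[ [ S ] ] ++ [ A ])
    ⊎ (∃[ i ] s ≡ [ S ] ++ i ×[ [ S ] ] ++ A ∷ [ A ])
    ⊎ (∃[ i ] s ≡ S ∷ [ S ] ++ i ×[ [ S ] ] ++ A ∷ [ N ])
    ⊎ (∃[ i ] s ≡ S ∷ A ∷ S ∷ [ A ] ++ i ×[ S ∷ [ A ] ])
    ⊎ (∃[ i ] s ≡ S ∷ A ∷ S ∷ [ A ] ++ i ×[ S ∷ [ A ] ] ++ [ A ])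
    ⊎ (∃[ i ] s ≡ S ∷ [ A ] ++ i ×[ S ∷ [ A ] ] ++ [ N ])
    )
theorem3p11 .(S ∷ t) t refl = mk⇔
  (λ (B , sym-B , epr) →
    let h , hs = EprFrom-tabulate B 0 (S ∷ t) epr
        _ , loop = SomeNonzero₁⇒loop B (proj₁ h)
        _ , loopless = ¬AllNonzero₁⇒loopless B (proj₂ h)
    in classify B sym-B loop loopless (h , hs) (tail-after-S B sym-B loop loopless 0 t h hs refl))
  λ where
    (inj₁ (i , j , refl))                               → attain-SN i j
    (inj₂ (inj₁ (i , refl)))                            → attain-SA i
    (inj₂ (inj₂ (inj₁ (i , refl))))                     → attain-SAA i
    (inj₂ (inj₂ (inj₂ (inj₁ (i , refl)))))              → attain-SSAN i
    -- This form starts with two blocks SA, whereas the argument of `attain-SA∗` counts the blocks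
    -- after the first.
    (inj₂ (inj₂ (inj₂ (inj₂ (inj₁ (i , refl))))))        → attain-SA∗ (suc i)
    (inj₂ (inj₂ (inj₂ (inj₂ (inj₂ (inj₁ (i , refl))))))) → attain-SA∗A (suc i)
    (inj₂ (inj₂ (inj₂ (inj₂ (inj₂ (inj₂ (i , refl))))))) → attain-SA∗N i
  where
  classify : ∀ (B : Matrix (length (S ∷ t))) (sym-B : Symmetric B) {u w} (loop : B u u ≡ 1ℙ) (loopless : B w w ≡ 0ℙ) →
    EprFrom B 0 (S ∷ t) → Tail B sym-B loop loopless t → _
  classify B sym-B loop loopless _ (inj₁ (i , j , refl))                       = inj₁ (i , j , refl)
  classify B sym-B loop loopless _ (inj₂ (inj₁ (i , refl)))                    = inj₂ (inj₁ (i , refl))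
  classify B sym-B loop loopless _ (inj₂ (inj₂ (inj₁ (i , refl))))             = inj₂ (inj₂ (inj₁ (i , refl)))
  -- SAN is the seventh form with no repeated block.
  classify B sym-B loop loopless _ (inj₂ (inj₂ (inj₂ (inj₁ (zero , refl)))))   =
      inj₂ (inj₂ (inj₂ (inj₂ (inj₂ (inj₂ (0 , refl))))))
  classify B sym-B loop loopless _ (inj₂ (inj₂ (inj₂ (inj₁ (suc i , refl)))))  = inj₂ (inj₂ (inj₂ (inj₁ (i , refl))))
  classify B sym-B loop loopless hs (inj₂ (inj₂ (inj₂ (inj₂ (4≤n , tight))))) =
    classify-alternating 4≤n (alternating B sym-B loop loopless tight 0 (S ∷ t) refl hs refl)
    where
    classify-alternating : 4 ≤ length (S ∷ t) → Alternating B sym-B loop loopless (S ∷ t) → _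
    -- The order is at least 4, so an alternating sequence ending in A has at least two blocks SA.
    classify-alternating (s≤s (s≤s ())) (inj₁ (suc zero , refl))
    classify-alternating _ (inj₁ (suc (suc i) , eq)) = inj₂ (inj₂ (inj₂ (inj₂ (inj₁ (i , eq)))))
    classify-alternating (s≤s (s≤s (s≤s ()))) (inj₂ (inj₁ (suc zero , refl)))
    classify-alternating _ (inj₂ (inj₁ (suc (suc i) , eq))) = inj₂ (inj₂ (inj₂ (inj₂ (inj₂ (inj₁ (i , eq))))))
    classify-alternating _ (inj₂ (inj₂ (suc i , eq))) = inj₂ (inj₂ (inj₂ (inj₂ (inj₂ (inj₂ (i , eq))))))
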